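{- Let $n\ge1$ and $P,Q\in\mathcal P(w_0^{(n+1)})$. If $\mathrm{ind}_\delta(P)=\mathrm{ind}_\delta(Q)$ for all $\delta\in\{\mathsf A,\mathsf D\}^{n-1}$, then $P\sim Q$.
   Context: Let $\mathfrak{S}_{n+1}$ be the symmetric group on $[n+1]$, $s_i=(i,i+1)$. A word $(i_1,\dots,i_r)$ of $w$ ($w=s_{i_1}\cdots s_{i_r}$) is reduced if $r$ is minimal; $\mathscr{R}(w)$ is the set of reduced words. $w_0^{(n+1)}$ is the longest element of $\mathfrak S_{n+1}$. A word poset is a finite poset $P$ with a function $f_P:P\to\mathbb{Z}_{>0}$ ($x$ is "in column $f_P(x)$"); $P\sim Q$ if there is a poset isomorphism $\phi$ with $f_Q\circ\phi=f_P$. For $\mathbf i=(i_1,\dots,i_\ell)\in\mathscr R(w)$, $P_{\mathbf i}$ is the poset on $[\ell]$ generated (reflexive transitive closure) by $j<k$ for $j<k$ with $|i_j-i_k|=1$, with $f_{P_{\mathbf i}}(j)=i_j$. $\mathcal P(w)$ is the set of word posets isomorphic to some $P_{\mathbf i}$, $\mathbf i\in\mathscr R(w)$. For $P\in\mathcal P(w_0^{(n+1)})$ there is a unique chain $\mathsf D(P)=\{d_1<_P\cdots<_P d_n\}$ with $f_P(d_i)=n+1-i$ and a unique chain $\mathsf A(P)=\{a_1<_P\cdots<_P a_n\}$ with $f_P(a_i)=i$. Define $\mathrm{ind}_{\mathsf D}(P)=\sum_i\#\{k: k>_P d_i,\ f_P(k)=f_P(d_i)\}$ and $\mathrm{ind}_{\mathsf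 A}(P)=\sum_i\#\{k: k>_P a_i,\ f_P(k)=f_P(a_i)\}$. Let $I_{\mathsf D}(P)=\{k: k<_P d_i,\ f_P(k)=f_P(d_i)\text{ for some } i\}$, $I_{\mathsf A}(P)=\{k: k<_P a_i,\ f_P(k)=f_P(a_i)\text{ for some }i\}$. $C_{\mathsf D}(P)$ is $P\setminus\mathsf D(P)$ with induced order and $f_{C_{\mathsf D}(P)}(k)=f_P(k)$ for $k\in I_{\mathsf D}(P)$, $f_P(k)-1$ otherwise; $C_{\mathsf A}(P)$ is $P\setminus\mathsf A(P)$ with induced order and $f_{C_{\mathsf A}(P)}(k)=f_P(k)-1$ for $k\in I_{\mathsf A}(P)$, $f_P(k)$ otherwise. Both lie in $\mathcal P(w_0^{(n)})$. For $\delta=(\delta_1,\dots,\delta_{n-1})\in\{\mathsf A,\mathsf D\}^{n-1}$, $\mathrm{ind}_\delta(P)=(I_1,\dots,I_{n-1})$ where $I_k=\mathrm{ind}_{\delta_k}(C_{\delta_{k+1}}\circ\cdots\circ C_{\delta_{n-1}}(P))$. -}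

module Defs where

open import Data.Bool using (Bool; true; false; _∧_; _∨_; not; if_then_else_)
open import Data.Nat using (ℕ; zero; suc; _+_; _∸_; _≤_; _≡ᵇ_; _<ᵇ_)
open import Data.Fin using (Fin; toℕ)
import Data.Fin as Fin
open import Data.List using (List; []; _∷_; length; lookup; filterᵇ; map; concatMap; reverse; downFrom; upTo)
open import Data.Bool.ListAction using (any)
open import Data.Nat.ListAction using (sum)
open import Data.List.Relation.Unary.All using (All)
open import Data.Vec using (Vec; toList)
open import Data.Maybe using (Maybe; just; nothing)
open import Data.Product using (Σ; _×_)
open import Relation.Nullary.Decidable using (⌊_⌋)
open import Relation.Binary.PropositionalEquality using (_≡_)
open import Function.Bundles using (_↔_; Inverse)

-- Permutations of [n+1] = {1,…,n+1}, acting on ℕ (positions 1..n+1).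

sw : ℕ → ℕ → ℕ
sw a x = if x ≡ᵇ a then suc a else (if x ≡ᵇ suc a then a else x)

evalWord : List ℕ → ℕ → ℕ
evalWord []       x = x
evalWord (a ∷ is) x = sw a (evalWord is x)

w0 : ℕ → (ℕ → ℕ)
w0 n x = (suc (suc n)) ∸ x

IsWordOf : ℕ → (ℕ → ℕ) → List ℕ → Set
IsWordOf n w is =
  All (λ a → 1 ≤ a × a ≤ n) is ×
  (∀ x → 1 ≤ x → x ≤ suc n → evalWord is x ≡ w x)

IsReducedWordOf : ℕ → (ℕ → ℕ) → List ℕ → Set
IsReducedWordOf n w is =
  IsWordOf n w is × (∀ js → IsWordOf n w js → length is ≤ length js)

record WordPoset : Set where
  field
    size : ℕ
    le   : Fin size → Fin size → Bool
    col  : Fin size → ℕ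
open WordPoset public

eqF : {m : ℕ} → Fin m → Fin m → Bool
eqF x y = ⌊ x Fin.≟ y ⌋

lt : (P : WordPoset) → Fin (size P) → Fin (size P) → Bool
lt P x y = le P x y ∧ not (eqF x y)

record _∼_ (P Q : WordPoset) : Set where
  field
    iso      : Fin (size P) ↔ Fin (size Q)
    le-pres  : ∀ x y → le P x y ≡ le Q (Inverse.to iso x) (Inverse.to iso y)
    col-pres : ∀ x → col Q (Inverse.to iso x) ≡ col P x

module _ (is : List ℕ) where
  private
    m = length is
    c : Fin m → ℕ
    c = lookup is
    allF = Data.List.allFin m
    cover : Fin m → Fin m → Bool
    cover j k = (toℕ j <ᵇ toℕ k) ∧ ((suc (c j) ≡ᵇ c k) ∨ (suc (c k) ≡ᵇ c j))
    reach : ℕ → Fin m → Fin m → Bool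
    reach zero    j k = eqF j k
    reach (suc t) j k = eqF j k ∨ any (λ l → cover j l ∧ reach t l k) allF

  -- reflexive-transitive closure (paths of length ≤ m suffice)
  wordPoset : WordPoset
  wordPoset = record { size = m ; le = reach m ; col = c }

InP-w0 : ℕ → WordPoset → Set
InP-w0 n P = Σ (List ℕ) λ is → IsReducedWordOf n (w0 n) is × (P ∼ wordPoset is)

-- Chains D(P), A(P), indices and contractions; parameter c is such that
-- P ∈ 𝓟(w_0^{(c+1)}) (so the chains have c elements).

data Dir : Set where
  A D : Dir

count : {X : Set} → (X → Bool) → List X → ℕ
count p xs = length (filterᵇ p xs)

module _ (P : WordPoset) where
  private
    m = size P
    allF = Data.List.allFin m

  inCol : ℕ → List (Fin m)
  inCol k = filterᵇ (λ x → col P x ≡ᵇ k) allF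

  tuples : List ℕ → List (List (Fin m))
  tuples []       = [] ∷ []
  tuples (k ∷ ks) = concatMap (λ x → map (x ∷_) (tuples ks)) (inCol k)

  isChain : List (Fin m) → Bool
  isChain []           = true
  isChain (x ∷ [])     = true
  isChain (x ∷ y ∷ xs) = lt P x y ∧ isChain (y ∷ xs)

  colsOf : Dir → ℕ → List ℕ
  colsOf D c = map suc (downFrom c)
  colsOf A c = map suc (upTo c)

  -- the (unique, for P ∈ 𝓟(w_0^{(c+1)})) chain D(P) resp. A(P)
  chain : Dir → ℕ → List (Fin m)
  chain δ c with filterᵇ isChain (tuples (colsOf δ c))
  ... | []     = []
  ... | ds ∷ _ = ds

  memb : Fin m → List (Fin m) → Bool
  memb x = any (eqF x)

  ind : Dir → ℕ → ℕ
  ind δ c = sum (map (λ d → count (λ k → lt P d k ∧ (col P k ≡ᵇ col P d)) allF) (chain δ c))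

  inI : Dir → ℕ → Fin m → Bool
  inI δ c k = any (λ d → lt P k d ∧ (col P k ≡ᵇ col P d)) (chain δ c)

  contract : Dir → ℕ → WordPoset
  contract δ c = record
    { size = length rest
    ; le   = λ j k → le P (lookup rest j) (lookup rest k)
    ; col  = λ j → newCol δ (lookup rest j)
    }
    where
    rest : List (Fin m)
    rest = filterᵇ (λ x → not (memb x (chain δ c))) allF
    newCol : Dir → Fin m → ℕ
    newCol D k = if inI D c k then col P k else col P k ∸ 1
    newCol A k = if inI A c k then col P k ∸ 1 else col P k

-- processes δ_{n-1}, δ_{n-2}, … ; outputs I_{n-1}, I_{n-2}, …
indGo : ℕ → List Dir → WordPoset → List ℕ
indGo c []       P = []
indGo c (δ ∷ ds) P = ind P δ c ∷ indGo (c ∸ 1) ds (contract P δ c)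

indSeq : (n : ℕ) → Vec Dir (n ∸ 1) → WordPoset → List ℕ
indSeq n δ P = reverse (indGo n (reverse (toList δ)) P)

{-# OPTIONS --safe #-}
module Submission where

open import Defs
open import Data.Bool using (Bool; true; false; _∧_; _∨_; not; if_then_else_; T?)
import Data.Bool.Properties as Boolₚ
open import Data.Bool.ListAction using (any)
open import Data.Empty using (⊥)
open import Data.Fin using (Fin; toℕ; fromℕ<)
import Data.Fin as Fin
open import Data.Fin.Properties using (toℕ-fromℕ<; toℕ<n; toℕ-injective)
open import Data.List using (List; []; _∷_; _++_; _∷ʳ_; allFin; applyDownFrom; applyUpTo; concat; downFrom; filterᵇ; length; lookup; map; replicate; reverse; upTo)
open import Data.List.Membership.Propositional using (_∈_; _∉_; find; lose)
open import Data.List.Membership.Propositional.Properties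
  using (∈-∃++; ∈-++⁺ˡ; ∈-++⁺ʳ; ∈-++⁻; ∈-allFin; ∈-concat⁺′; ∈-concat⁻′; ∈-concatMap⁺; ∈-concatMap⁻; ∈-downFrom⁺; ∈-filter⁺; ∈-filter⁻; ∈-lookup; ∈-map⁺; ∈-map⁻)
open import Data.List.Properties
  using (∷-injective; length-++; length-map; length-replicate; length-reverse; map-∘; map-downFrom; map-upTo; reverse-injective; reverse-involutive)
open import Data.List.Relation.Binary.Permutation.Propositional using (_↭_; ↭-sym)
open import Data.List.Relation.Binary.Permutation.Propositional.Properties using (↭-length; filter-↭; ∈-resp-↭; ∷↭∷ʳ)
open import Data.List.Relation.Unary.All as All using (All; []; _∷_)
import Data.List.Relation.Unary.All.Properties as Allₚ
import Data.List.Relation.Unary.AllPairs as AllPairs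
import Data.List.Relation.Unary.AllPairs.Properties as AllPairsₚ
open import Data.List.Relation.Unary.Any as Any using (here; there)
import Data.List.Relation.Unary.Any.Properties as Anyₚ
open import Data.List.Relation.Unary.Unique.Propositional using (Unique; []; _∷_)
import Data.List.Relation.Unary.Unique.Propositional.Properties as Uniqueₚ
open import Data.Nat using (ℕ; zero; suc; _+_; _∸_; _≤_; _<_; z≤n; s≤s; _≡ᵇ_; _<ᵇ_; _≟_; _≤?_)
open import Data.Nat.ListAction using (sum)
open import Data.Nat.Properties
open import Data.Product as Product using (∃; _×_; _,_; proj₁; proj₂)
open import Data.Product.Properties using (≡-dec)
open import Data.Sum as Sum using (_⊎_; inj₁; inj₂)
open import Data.Vec using (Vec; fromList; toList)
open import Data.Vec.Properties using (toList∘fromList)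
open import Function using (_∘_)
open import Function.Bundles using (Equivalence; Inverse; mk↔ₛ′)
open import Function.Properties.Inverse using (↔-sym; ↔-trans)
open import Relation.Binary.Definitions using (tri<; tri≈; tri>)
open import Relation.Binary.PropositionalEquality using (_≡_; _≢_; refl; sym; trans; cong; cong₂; subst; subst₂; module ≡-Reasoning)
open import Relation.Nullary using (¬_; Dec; yes; no; contradiction)
open import Relation.Nullary.Decidable using (_×-dec_; _⊎-dec_)

-- A reduced word of w₀ is a wiring diagram in which any two of n + 1 lines cross exactly once, and
-- its commutation class is determined by the triple data: which lines are below which crossings.
-- The chains D and A are the crossings on the last and on the first line, contracting them deletes
-- that line, and ind_D counts the crossings that have the last line below them.
--
-- So contractions restrict the diagram to intervals [a,b] of lines. By induction the data of
-- [a,b-1] and [a+1,b] are known, and only the triples a < x < b remain, where the bit to determine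
-- is whether line a meets b before x. The order in which a meets the lines x is known, so these x
-- form a final segment of a known order, and ind_D gives its size.
--
-- The order that a contraction inherits may be strictly finer than the heap order of the contracted
-- word: if a word of w₀ in 𝔖₆ begins with 4 5 4 3 2 1 2, then contracting the chain 5 4 3 2 1
-- leaves the commuting letters 4 and 1 comparable.
-- Therefore a contraction is described by an embedding into the crossings of the original diagram
-- (Embedded, Model) and not as an element of 𝓟(w₀).

-- On the interval [a,b] the index for D counts every pair u < v in [a,b-1] whose crossing has b
-- below it, not only the pairs with u = a. The pairs with u > a lie in [a+1,b], where everything is
-- known, so the index determines how many lines x meet a after b does. Two diagrams that differed
-- in these x would have one list of pairs strictly inside the other, against equal lengths. The
-- recursion stops at two lines, where there is no triple; this is why n-1 directions suffice for
-- n+1 lines. The obstacle throughout is comparability. The chains need crossings in one column to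
-- be comparable, and the reconstruction needs this for crossings in neighbouring columns, although
-- such crossings need not share a line. Both follow from a single property of the order, that
-- crossings on a common line are comparable in order of time. It passes to contractions and can be
-- transported from one word to the other.

∧-true⁻ : ∀ {a b} → a ∧ b ≡ true → a ≡ true × b ≡ true
∧-true⁻ {true} e = refl , e

∧-true⁺ : ∀ {a b} → a ≡ true → b ≡ true → a ∧ b ≡ true
∧-true⁺ refl refl = refl

true⇔⇒≡ : ∀ {a b} → (a ≡ true → b ≡ true) → (b ≡ true → a ≡ true) → a ≡ b
true⇔⇒≡ {true}  {b}     f g = sym (f refl)
true⇔⇒≡ {false} {true}  f g = g refl
true⇔⇒≡ {false} {false} f g = refl

<ᵇ-true⁺ : ∀ {a b} → a < b → (a <ᵇ b) ≡ true
<ᵇ-true⁺ p = Equivalence.to Boolₚ.T-≡ (<⇒<ᵇ p)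

<ᵇ-true⁻ : ∀ a b → (a <ᵇ b) ≡ true → a < b
<ᵇ-true⁻ a b e = <ᵇ⇒< a b (Equivalence.from Boolₚ.T-≡ e)

≡ᵇ-true⁺ : ∀ {a b} → a ≡ b → (a ≡ᵇ b) ≡ true
≡ᵇ-true⁺ {a} {b} p = Equivalence.to Boolₚ.T-≡ (≡⇒≡ᵇ a b p)

≡ᵇ-true⁻ : ∀ a b → (a ≡ᵇ b) ≡ true → a ≡ b
≡ᵇ-true⁻ a b e = ≡ᵇ⇒≡ a b (Equivalence.from Boolₚ.T-≡ e)

module _ {X : Set} (p : X → Bool) where

  any-true⁻ : ∀ xs → any p xs ≡ true → ∃ λ x → x ∈ xs × p x ≡ true
  any-true⁻ (x ∷ xs) e with p x in px
  ... | true  = x , here refl , px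
  ... | false with y , y∈ , py ← any-true⁻ xs e = y , there y∈ , py

  any-true⁺ : ∀ {x xs} → x ∈ xs → p x ≡ true → any p xs ≡ true
  any-true⁺ (here refl) e rewrite e = refl
  any-true⁺ {xs = y ∷ _} (there x∈) e with p y
  ... | true  = refl
  ... | false = any-true⁺ x∈ e

  ∈-filterᵇ⁺ : ∀ {x xs} → x ∈ xs → p x ≡ true → x ∈ filterᵇ p xs
  ∈-filterᵇ⁺ x∈ e = ∈-filter⁺ (T? ∘ p) x∈ (Equivalence.from Boolₚ.T-≡ e)

  ∈-filterᵇ⁻ : ∀ {x} xs → x ∈ filterᵇ p xs → x ∈ xs × p x ≡ true
  ∈-filterᵇ⁻ xs x∈ with a , b ← ∈-filter⁻ (T? ∘ p) {xs = xs} x∈ = a , Equivalence.to Boolₚ.T-≡ b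

  count-↭ : ∀ {xs ys} → xs ↭ ys → count p xs ≡ count p ys
  count-↭ e = ↭-length (filter-↭ (T? ∘ p) e)

  count-all : ∀ {xs} → (∀ {x} → x ∈ xs → p x ≡ true) → count p xs ≡ length xs
  count-all {[]} h = refl
  count-all {x ∷ xs} h rewrite h (here refl) = cong suc (count-all (h ∘ there))

  count-none : ∀ {xs} → (∀ {x} → x ∈ xs → p x ≡ false) → count p xs ≡ 0
  count-none {[]} h = refl
  count-none {x ∷ xs} h rewrite h (here refl) = count-none (h ∘ there)

  count-∷-true : ∀ {x xs} → p x ≡ true → count p (x ∷ xs) ≡ suc (count p xs)
  count-∷-true e rewrite e = refl

  count-∷-false : ∀ {x xs} → p x ≡ false → count p (x ∷ xs) ≡ count p xs
  count-∷-false e rewrite e = refl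

module _ {X : Set} where

  count-cong : ∀ {p q : X → Bool} {xs} → (∀ {x} → x ∈ xs → p x ≡ q x) → count p xs ≡ count q xs
  count-cong {xs = []} h = refl
  count-cong {q = q} {xs = x ∷ xs} h rewrite h (here refl) with q x
  ... | true  = cong suc (count-cong (h ∘ there))
  ... | false = count-cong (h ∘ there)

  -- The form in which one crossing changes a level: the two predicates belong to neighbouring lines
  -- or times and differ only at the line that is being crossed.
  count-single : ∀ {p q : X → Bool} {xs y} → Unique xs → y ∈ xs → p y ≡ true → q y ≡ false →
                 (∀ {x} → x ∈ xs → x ≢ y → p x ≡ q x) → count p xs ≡ suc (count q xs)
  count-single {p} {q} (x∉ ∷ u) (here refl) py qy h rewrite py | qy =
    cong suc (count-cong λ x∈ → h (there x∈) λ { refl → All.lookup x∉ x∈ refl })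
  count-single {p} {q} {x ∷ xs} (x∉ ∷ u) (there y∈) py qy h
    rewrite h (here refl) (λ { refl → All.lookup x∉ y∈ refl }) with q x
  ... | true  = cong suc (count-single u y∈ py qy (h ∘ there))
  ... | false = count-single u y∈ py qy (h ∘ there)

  count-≤ : ∀ {p q : X → Bool} xs → (∀ {x} → p x ≡ true → q x ≡ true) → count p xs ≤ count q xs
  count-≤ [] h = z≤n
  count-≤ {p} {q} (x ∷ xs) h with p x in px | q x in qx
  ... | true  | true  = s≤s (count-≤ xs h)
  ... | true  | false with () ← trans (sym qx) (h px)
  ... | false | true  = m≤n⇒m≤1+n (count-≤ xs h)
  ... | false | false = count-≤ xs h

  count-< : ∀ {p q : X → Bool} {xs y} → (∀ {x} → p x ≡ true → q x ≡ true) →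
            y ∈ xs → p y ≡ false → q y ≡ true → count p xs < count q xs
  count-< {p} {q} {xs = _ ∷ xs} h (here refl) py qy rewrite py | qy = s≤s (count-≤ xs h)
  count-< {p} {q} {xs = x ∷ xs} h (there y∈) py qy with p x in px | q x in qx
  ... | true  | true  = s≤s (count-< h y∈ py qy)
  ... | true  | false with () ← trans (sym qx) (h px)
  ... | false | true  = m≤n⇒m≤1+n (count-< h y∈ py qy)
  ... | false | false = count-< h y∈ py qy

  unique-⊆⇒length-≤ : ∀ {xs ys : List X} → Unique xs → (∀ {x} → x ∈ xs → x ∈ ys) → length xs ≤ length ys
  unique-⊆⇒length-≤ [] h = z≤n
  unique-⊆⇒length-≤ {x ∷ xs} (x∉ ∷ u) h with as , bs , refl ← ∈-∃++ (h (here refl)) =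
    ≤-trans (s≤s (unique-⊆⇒length-≤ {ys = as ++ bs} u drop-x))
      (≤-reflexive (begin
        suc (length (as ++ bs))        ≡⟨ cong suc (length-++ as) ⟩
        suc (length as + length bs)    ≡⟨ sym (+-suc (length as) (length bs)) ⟩
        length as + suc (length bs)    ≡⟨ sym (length-++ as) ⟩
        length (as ++ x ∷ bs)          ∎))
    where
    open ≡-Reasoning
    drop-x : ∀ {y} → y ∈ xs → y ∈ as ++ bs
    drop-x y∈ with ∈-++⁻ as (h (there y∈))
    ... | inj₁ i           = ∈-++⁺ˡ i
    ... | inj₂ (here refl) = contradiction refl (All.lookup x∉ y∈)
    ... | inj₂ (there i)   = ∈-++⁺ʳ as i

  -- Pigeonhole: an element of `ys` missing from `xs` could be put in front of `xs`, and the longer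
  -- list would still be free of repetitions and contained in `ys`.
  unique-⊆-length⇒⊇ : ∀ {xs ys : List X} → (∀ x y → Dec (x ≡ y)) → Unique xs → (∀ {x} → x ∈ xs → x ∈ ys) →
                      length ys ≤ length xs → ∀ {y} → y ∈ ys → y ∈ xs
  unique-⊆-length⇒⊇ {xs} {ys} _≟′_ u h l {y} y∈ with y ∈? xs
    where
    open import Data.List.Membership.DecPropositional _≟′_ using (_∈?_)
  ... | yes y∈xs = y∈xs
  ... | no  y∉xs = contradiction
    (≤-trans (unique-⊆⇒length-≤ {ys = ys} (All.tabulate (λ x∈ e → y∉xs (subst (_∈ xs) (sym e) x∈)) ∷ u)
               λ { (here refl) → y∈ ; (there x∈) → h x∈ }) l)
    (<-irrefl refl)

-- A wiring diagram with m crossings, numbered by time; below t u v says that line u is below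
-- line v just before crossing t, so t ranges over 0, …, m. The line lo s is the lower one before s.
record Arrangement (m : ℕ) : Set₁ where
  field
    Line   : ℕ → Set
    below  : ℕ → ℕ → ℕ → Bool
    lo hi  : Fin m → ℕ

  Crosses : Fin m → ℕ → ℕ → Set
  Crosses s u v = (u ≡ lo s × v ≡ hi s) ⊎ (u ≡ hi s × v ≡ lo s)

  field
    below-flip  : ∀ t {u v} → u ≢ v → below t u v ≡ not (below t v u)
    below-irr   : ∀ t u → below t u u ≡ false
    below-trans : ∀ t {u v w} → below t u v ≡ true → below t v w ≡ true → below t u w ≡ true
    below-lohi  : ∀ s → below (toℕ s) (lo s) (hi s) ≡ true
    below-adj   : ∀ s {w} → w ≢ lo s → w ≢ hi s → below (toℕ s) w (lo s) ≡ below (toℕ s) w (hi s)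
    below-swap  : ∀ s → below (suc (toℕ s)) (hi s) (lo s) ≡ true
    below-keep  : ∀ s {u v} → ¬ Crosses s u v → below (suc (toℕ s)) u v ≡ below (toℕ s) u v
    once        : ∀ s t → Crosses t (lo s) (hi s) → s ≡ t
    final       : ∀ {u v} → Line u → Line v → u ≢ v → below m u v ≡ below 0 v u

-- Turns the diagram upside down, so that the first line starts on top and the chain `A` can be
-- treated like the chain `D`.
mirror : ∀ {m} → Arrangement m → Arrangement m
mirror arr = record
  { Line = Line
  ; below = λ t u v → below t v u
  ; lo = hi ; hi = lo
  ; below-flip = λ t u≢v → below-flip t (u≢v ∘ sym)
  ; below-irr = below-irr
  ; below-trans = λ t uv vw → below-trans t vw uv
  ; below-lohi = below-lohi
  ; below-adj = λ s {w} w≢lo w≢hi → trans (below-flip _ (w≢lo ∘ sym))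
      (trans (cong not (sym (below-adj s w≢hi w≢lo))) (sym (below-flip _ (w≢hi ∘ sym))))
  ; below-swap = below-swap
  ; below-keep = λ s ¬c → below-keep s λ { (inj₁ (a , b)) → ¬c (inj₁ (b , a)) ; (inj₂ (a , b)) → ¬c (inj₂ (b , a)) }
  ; once = λ { s t (inj₁ (a , b)) → once s t (inj₁ (b , a)) ; s t (inj₂ (a , b)) → once s t (inj₂ (b , a)) }
  ; final = λ lu lv u≢v → final lv lu (u≢v ∘ sym)
  }
  where open Arrangement arr

-- Pairs of lines and their crossing

module ArrangementProperties {m : ℕ} (arr : Arrangement m) where
  open Arrangement arr

  On : ℕ → Fin m → Set
  On u s = u ≡ lo s ⊎ u ≡ hi s

  lo≢hi : ∀ s → lo s ≢ hi s
  lo≢hi s e with () ← trans (sym (below-lohi s)) (trans (cong (below _ (lo s)) (sym e)) (below-irr _ (lo s)))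

  below-hilo : ∀ s → below (toℕ s) (hi s) (lo s) ≡ false
  below-hilo s = trans (below-flip _ (lo≢hi s ∘ sym)) (cong not (below-lohi s))

  Crosses? : ∀ s u v → Dec (Crosses s u v)
  Crosses? s u v = ((u ≟ lo s) ×-dec (v ≟ hi s)) ⊎-dec ((u ≟ hi s) ×-dec (v ≟ lo s))

  Crosses-sym : ∀ {s u v} → Crosses s u v → Crosses s v u
  Crosses-sym (inj₁ (a , b)) = inj₂ (b , a)
  Crosses-sym (inj₂ (a , b)) = inj₁ (b , a)

  Crosses⇒On : ∀ {s u v} → Crosses s u v → On u s
  Crosses⇒On (inj₁ (a , _)) = inj₁ a
  Crosses⇒On (inj₂ (a , _)) = inj₂ a

  partner : ∀ {u s} → On u s → ∃ λ v → u ≢ v × Crosses s u v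
  partner {s = s} (inj₁ refl) = hi s , lo≢hi s , inj₁ (refl , refl)
  partner {s = s} (inj₂ refl) = lo s , lo≢hi s ∘ sym , inj₂ (refl , refl)

  on-both : ∀ {s u v} → u ≢ v → On u s → On v s → Crosses s u v
  on-both u≢v (inj₁ e) (inj₂ e′) = inj₁ (e , e′)
  on-both u≢v (inj₂ e) (inj₁ e′) = inj₂ (e , e′)
  on-both u≢v (inj₁ e) (inj₁ e′) = contradiction (trans e (sym e′)) u≢v
  on-both u≢v (inj₂ e) (inj₂ e′) = contradiction (trans e (sym e′)) u≢v

  once′ : ∀ {s t u v} → Crosses s u v → Crosses t u v → s ≡ t
  once′ {s} {t} (inj₁ (refl , refl)) c = once s t c
  once′ {s} {t} (inj₂ (refl , refl)) c = once s t (Crosses-sym c)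

  exists-crossing : ∀ {i j u v} → i ≤ j → j ≤ m → below i u v ≢ below j u v →
                    ∃ λ s → i ≤ toℕ s × toℕ s < j × Crosses s u v
  exists-crossing {i} {zero} z≤n _ ne = contradiction refl ne
  exists-crossing {i} {suc j} {u} {v} i≤j j<m ne with m≤n⇒m<n∨m≡n i≤j
  ... | inj₂ refl = contradiction refl ne
  ... | inj₁ (s≤s i≤j′) with Crosses? (fromℕ< j<m) u v
  ...   | yes c = fromℕ< j<m , subst (i ≤_) (sym e) i≤j′ , subst (_< suc j) (sym e) ≤-refl , c
    where e = toℕ-fromℕ< j<m
  ...   | no ¬c with s , i≤s , s<j , c ← exists-crossing i≤j′ (<⇒≤ j<m)
                    (λ eq → ne (trans eq (sym (subst (λ k → below (suc k) u v ≡ below k u v) (toℕ-fromℕ< j<m) (below-keep _ ¬c)))))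
          = s , i≤s , m<n⇒m<1+n s<j , c

  below-const : ∀ {i j u v} → i ≤ j → j ≤ m →
                (∀ s → i ≤ toℕ s → toℕ s < j → ¬ Crosses s u v) → below i u v ≡ below j u v
  below-const {i} {j} {u} {v} i≤j j≤m h with below i u v Boolₚ.≟ below j u v
  ... | yes e = e
  ... | no ne with s , i≤s , s<j , c ← exists-crossing i≤j j≤m ne = contradiction c (h s i≤s s<j)

  below-before : ∀ {s t u v} → Crosses s u v → t ≤ toℕ s → below t u v ≡ below (toℕ s) u v
  below-before {s} c t≤s = below-const t≤s (<⇒≤ (toℕ<n s))
    λ r _ r<s c′ → <-irrefl (cong toℕ (once′ c′ c)) r<s

  below-after : ∀ {s t u v} → Crosses s u v → toℕ s < t → t ≤ m → below t u v ≡ below (suc (toℕ s)) u v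
  below-after {s} c s<t t≤m = sym (below-const s<t t≤m
    λ r s<r _ c′ → <-irrefl (cong toℕ (once′ c c′)) s<r)

  flip-Crosses : ∀ {s u v} → Crosses s u v → below (suc (toℕ s)) u v ≡ not (below (toℕ s) u v)
  flip-Crosses {s} (inj₁ (refl , refl)) = trans (trans (below-flip _ (lo≢hi s)) (cong not (below-swap s)))
    (cong not (sym (below-lohi s)))
  flip-Crosses {s} (inj₂ (refl , refl)) = trans (below-swap s) (cong not (sym (below-hilo s)))

  below-after-0 : ∀ {s t u v} → Crosses s u v → toℕ s < t → t ≤ m → below t u v ≡ not (below 0 u v)
  below-after-0 c s<t t≤m = trans (below-after c s<t t≤m)
    (trans (flip-Crosses c) (cong not (sym (below-before c z≤n))))

  -- `final` reverses the initial order of the two lines, so it must change at some crossing.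
  lines-cross : ∀ {u v} → Line u → Line v → u ≢ v → ∃ λ s → Crosses s u v
  lines-cross {u} {v} lu lv u≢v
    with s , _ , _ , c ← exists-crossing {0} {m} {u} {v} z≤n ≤-refl
           (λ e → Boolₚ.not-¬ e (trans (below-flip 0 u≢v) (cong not (sym (final lu lv u≢v)))))
    = s , c

-- Levels of lines relative to a set of lines

module Levels {m : ℕ} (arr : Arrangement m) (ls : List ℕ) (unique : Unique ls) where
  open Arrangement arr
  open ArrangementProperties arr

  -- The height of `u`, counted from 0, in the diagram that keeps only the lines of `ls`.
  -- Restricting the count instead of the diagram keeps all contractions on one time scale.
  level : ℕ → ℕ → ℕ
  level t u = count (λ v → below t v u) ls

  Inside : Fin m → Set
  Inside s = lo s ∈ ls × hi s ∈ ls

  level-same : ∀ {s u} → (∀ {v} → v ∈ ls → ¬ Crosses s v u) → level (suc (toℕ s)) u ≡ level (toℕ s) u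
  level-same {s} h = count-cong λ v∈ → below-keep s (h v∈)

  level-outside : ∀ {s u} → ¬ Inside s → u ∈ ls → level (suc (toℕ s)) u ≡ level (toℕ s) u
  level-outside ¬in u∈ = level-same λ where
    v∈ (inj₁ (refl , refl)) → ¬in (v∈ , u∈)
    v∈ (inj₂ (refl , refl)) → ¬in (u∈ , v∈)

  level-not-on : ∀ {s u} → ¬ On u s → level (suc (toℕ s)) u ≡ level (toℕ s) u
  level-not-on ¬on = level-same λ where
    _ (inj₁ (_ , e)) → ¬on (inj₂ e)
    _ (inj₂ (_ , e)) → ¬on (inj₁ e)

  -- By `below-adj` the two lines of `s` have the same lines below them, apart from `lo s`, which is
  -- below `hi s`.
  level-hi : ∀ {s} → Inside s → level (toℕ s) (hi s) ≡ suc (level (toℕ s) (lo s))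
  level-hi {s} (l∈ , h∈) = count-single unique l∈ (below-lohi s) (below-irr _ (lo s)) pointwise
    where
    pointwise : ∀ {v} → v ∈ ls → v ≢ lo s → below (toℕ s) v (hi s) ≡ below (toℕ s) v (lo s)
    pointwise {v} _ v≢lo with v ≟ hi s
    ... | yes refl = trans (below-irr _ (hi s)) (sym (below-hilo s))
    ... | no v≢hi  = sym (below-adj s v≢lo v≢hi)

  level-hi-after : ∀ {s} → level (suc (toℕ s)) (hi s) ≡ level (toℕ s) (lo s)
  level-hi-after {s} = count-cong pointwise
    where
    pointwise : ∀ {v} → v ∈ ls → below (suc (toℕ s)) v (hi s) ≡ below (toℕ s) v (lo s)
    pointwise {v} _ with v ≟ lo s | v ≟ hi s
    ... | yes refl | _        = trans (trans (below-flip _ (lo≢hi s)) (cong not (below-swap s))) (sym (below-irr _ (lo s)))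
    ... | no _     | yes refl = trans (below-irr _ (hi s)) (sym (below-hilo s))
    ... | no v≢lo  | no v≢hi  = trans (below-keep s λ { (inj₁ (e , _)) → v≢lo e ; (inj₂ (e , _)) → v≢hi e })
                                      (sym (below-adj s v≢lo v≢hi))

  level-lo-after : ∀ {s} → Inside s → level (suc (toℕ s)) (lo s) ≡ suc (level (toℕ s) (lo s))
  level-lo-after {s} (l∈ , h∈) = count-single unique h∈ (below-swap s) (below-hilo s) pointwise
    where
    pointwise : ∀ {v} → v ∈ ls → v ≢ hi s → below (suc (toℕ s)) v (lo s) ≡ below (toℕ s) v (lo s)
    pointwise {v} _ v≢hi with v ≟ lo s
    ... | yes refl = trans (below-irr _ (lo s)) (sym (below-irr _ (lo s)))
    ... | no v≢lo  = below-keep s λ { (inj₁ (e , _)) → v≢lo e ; (inj₂ (e , _)) → v≢hi e }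

  level-< : ∀ {t u v} → u ∈ ls → below t u v ≡ true → level t u < level t v
  level-< {t} {u} u∈ b = count-< (λ b′ → below-trans t b′ b) u∈ (below-irr t u) b

  level-injective : ∀ {t u v} → u ∈ ls → v ∈ ls → level t u ≡ level t v → u ≡ v
  level-injective {t} {u} {v} u∈ v∈ e with u ≟ v
  ... | yes p = p
  ... | no u≢v with below t u v in b
  ...   | true  = contradiction (level-< u∈ b) (<-irrefl e)
  ...   | false = contradiction (level-< v∈ (trans (below-flip t (u≢v ∘ sym)) (cong not b))) (<-irrefl (sym e))

  level-<⁻ : ∀ {t u v} → v ∈ ls → level t u < level t v → below t u v ≡ true
  level-<⁻ {t} {u} {v} v∈ l with u ≟ v
  ... | yes refl = contradiction l (<-irrefl refl)
  ... | no u≢v with below t u v in b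
  ...   | true  = refl
  ...   | false = contradiction (level-< v∈ (trans (below-flip t (u≢v ∘ sym)) (cong not b))) (<-asym l)

  -- Invariant: from s on, the line at level p lies on some earlier crossing z with s ≼ z, because
  -- a line can enter that level only by crossing the line which occupied it.
  module _ (_≼_ : Fin m → Fin m → Set)
           (≼-refl : ∀ {s} → s ≼ s) (≼-trans : ∀ {r s t} → r ≼ s → s ≼ t → r ≼ t)
           (≼-share : ∀ {s t u} → On u s → On u t → toℕ s < toℕ t → s ≼ t) where

    same-level⇒≼ : ∀ {s t u v} → Inside s → Inside t → On u s → On v t →
                   level (toℕ s) u ≡ level (toℕ t) v → toℕ s < toℕ t → s ≼ t
    same-level⇒≼ {s} {t} {u} {v} s∈ t∈ us vt eq s<t =
      let z , z<t , vz , s≼z = invariant (toℕ t) s<t (<⇒≤ (toℕ<n t)) (On⇒∈ t∈ vt) (sym eq)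
      in ≼-trans s≼z (≼-share vz vt z<t)
      where
      On⇒∈ : ∀ {s u} → Inside s → On u s → u ∈ ls
      On⇒∈ (l , h) (inj₁ refl) = l
      On⇒∈ (l , h) (inj₂ refl) = h

      p = level (toℕ s) u

      Met : ℕ → Set
      Met j = ∀ {w} → w ∈ ls → level j w ≡ p → ∃ λ z → toℕ z < j × On w z × s ≼ z

      -- The two lines of `s` exchange levels, so right after `s` the level of `u` is occupied by
      -- the other line of `s`.
      start : ∀ {u} → On u s → ∀ {w} → w ∈ ls → level (suc (toℕ s)) w ≡ level (toℕ s) u → On w s
      start (inj₁ refl) w∈ e = inj₂ (level-injective w∈ (proj₂ s∈) (trans e (sym level-hi-after)))
      start (inj₂ refl) w∈ e = inj₁ (level-injective w∈ (proj₁ s∈)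
        (trans e (trans (level-hi s∈) (sym (level-lo-after s∈)))))

      Met-step : ∀ r → Met (toℕ r) → Met (suc (toℕ r))
      Met-step r met {w} w∈ e with w ≟ lo r | w ≟ hi r | lo r ∈? ls | hi r ∈? ls
        where
        open import Data.List.Membership.DecPropositional _≟_ using (_∈?_)
      -- `lo r` moves up to the level that `hi r` leaves. The earlier crossing known for `hi r`
      -- shares that line with `r`, so `r` becomes the new witness. The next case is symmetric.
      ... | yes refl | _ | yes l∈ | yes h∈
        with z , z<r , hz , s≼z ← met h∈ (trans (trans (level-hi (l∈ , h∈)) (sym (level-lo-after (l∈ , h∈)))) e)
        = r , ≤-refl , inj₁ refl , ≼-trans s≼z (≼-share hz (inj₂ refl) z<r)
      ... | no _ | yes refl | yes l∈ | yes h∈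
        with z , z<r , lz , s≼z ← met l∈ (trans (sym level-hi-after) e)
        = r , ≤-refl , inj₂ refl , ≼-trans s≼z (≼-share lz (inj₁ refl) z<r)
      ... | no w≢lo | no w≢hi | _ | _
        with z , z<r , wz , s≼z ← met w∈ (trans (sym (level-not-on λ { (inj₁ q) → w≢lo q ; (inj₂ q) → w≢hi q })) e)
        = z , m<n⇒m<1+n z<r , wz , s≼z
      -- A crossing that involves a line outside `ls` leaves the levels within `ls` unchanged.
      ... | _ | _ | no l∉ | _
        with z , z<r , wz , s≼z ← met w∈ (trans (sym (level-outside (λ i → l∉ (proj₁ i)) w∈)) e)
        = z , m<n⇒m<1+n z<r , wz , s≼z
      ... | _ | _ | _ | no h∉
        with z , z<r , wz , s≼z ← met w∈ (trans (sym (level-outside (λ i → h∉ (proj₂ i)) w∈)) e)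
        = z , m<n⇒m<1+n z<r , wz , s≼z

      invariant : ∀ j → toℕ s < j → j ≤ m → Met j
      invariant (suc j) (s≤s s≤j) j<m with m≤n⇒m<n∨m≡n s≤j
      ... | inj₂ refl = λ w∈ e → s , ≤-refl , start us w∈ e , ≼-refl
      ... | inj₁ s<j  = subst (λ k → Met (suc k)) (toℕ-fromℕ< j<m)
        (Met-step (fromℕ< j<m) (subst Met (sym (toℕ-fromℕ< j<m)) (invariant j s<j (<⇒≤ j<m))))

-- Chains of a word poset

length-concat : ∀ {A : Set} (xss : List (List A)) → length (concat xss) ≡ sum (map length xss)
length-concat []         = refl
length-concat (xs ∷ xss) = trans (length-++ xs) (cong (length xs +_) (length-concat xss))

eqF-true⁻ : ∀ {m} {x y : Fin m} → eqF x y ≡ true → x ≡ y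
eqF-true⁻ {x = x} {y} e with yes p ← x Fin.≟ y = p

eqF-refl : ∀ {m} (x : Fin m) → eqF x x ≡ true
eqF-refl x with x Fin.≟ x
... | yes _ = refl
... | no ne = contradiction refl ne

eqF-≢ : ∀ {m} {x y : Fin m} → x ≢ y → eqF x y ≡ false
eqF-≢ {x = x} {y} ne with x Fin.≟ y
... | yes e = contradiction e ne
... | no _  = refl

module _ (X : WordPoset) where

  ∈-tuples⁻ : ∀ ks {ds} → ds ∈ tuples X ks → map (col X) ds ≡ ks
  ∈-tuples⁻ [] (here refl) = refl
  ∈-tuples⁻ (k ∷ ks) ds∈
    with x , x∈ , ds∈′ ← find (∈-concatMap⁻ (λ x → map (x ∷_) (tuples X ks)) {xs = inCol X k} ds∈)
    with es , es∈ , refl ← ∈-map⁻ (x ∷_) ds∈′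
    = cong₂ _∷_ (≡ᵇ-true⁻ _ k (proj₂ (∈-filterᵇ⁻ _ (allFin (size X)) x∈))) (∈-tuples⁻ ks es∈)

  ∈-tuples⁺ : ∀ ds → ds ∈ tuples X (map (col X) ds)
  ∈-tuples⁺ [] = here refl
  ∈-tuples⁺ (d ∷ ds) = ∈-concatMap⁺ (λ x → map (x ∷_) (tuples X (map (col X) ds))) {xs = inCol X (col X d)}
    (lose (∈-filterᵇ⁺ (λ x → col X x ≡ᵇ col X d) (∈-allFin d) (≡ᵇ-true⁺ {col X d} refl)) (∈-map⁺ (d ∷_) (∈-tuples⁺ ds)))

  -- `chain` takes the first candidate and falls back to `[]`. The given `ds` rules out the
  -- fallback, and every candidate has both properties.
  chain-characterization : ∀ δ c {ds} → map (col X) ds ≡ colsOf X δ c → isChain X ds ≡ true →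
                           map (col X) (chain X δ c) ≡ colsOf X δ c × isChain X (chain X δ c) ≡ true
  chain-characterization δ c {ds} e ch =
    let ∈t , ic = ∈-filterᵇ⁻ (isChain X) (tuples X (colsOf X δ c)) chain∈ in ∈-tuples⁻ (colsOf X δ c) ∈t , ic
    where
    candidates = filterᵇ (isChain X) (tuples X (colsOf X δ c))
    chain∈ : chain X δ c ∈ candidates
    chain∈ with candidates | ∈-filterᵇ⁺ (isChain X) (subst (λ ks → ds ∈ tuples X ks) e (∈-tuples⁺ ds)) ch
    ... | es ∷ _ | _ = here refl

-- Along a chain of columns κ (c-1), …, κ 0 no element is left of the extremal line (propagates
-- forwards, since g decreases) and none is right of it (propagates backwards), so all lie on it.
record ExtremalLine (X : WordPoset) (δ : Dir) (c : ℕ) : Set₁ where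
  field
    κ           : ℕ → ℕ
    κ-injective : ∀ {i j} → i < c → j < c → κ i ≡ κ j → i ≡ j
    columns     : colsOf X δ c ≡ map κ (downFrom c)
    q           : Fin (size X) → ℕ
    q<c         : ∀ x → q x < c
    col≡κq      : ∀ x → col X x ≡ κ (q x)
    time        : Fin (size X) → ℕ
    time-inj    : ∀ {x y} → time x ≡ time y → x ≡ y
    lt⇒<        : ∀ {x y} → lt X x y ≡ true → time x < time y
    g           : ℕ → ℕ
    g≤c         : ∀ t → g t ≤ c
    g-antitone  : ∀ {x t} → t ≤ time x → g (time x) ≤ g t
    On          : Fin (size X) → Set
    on-before   : ∀ {x} → On x → g (time x) ≡ suc (q x)
    on-after    : ∀ {x} → On x → g (suc (time x)) ≡ q x
    off-after   : ∀ {x} → g (time x) < q x → g (suc (time x)) ≤ q x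
    trichotomy  : ∀ x → On x ⊎ suc (q x) < g (time x) ⊎ g (time x) < q x
    on-exists   : ∀ {r} → r < c → ∃ λ x → On x × q x ≡ r
    on-comparable  : ∀ {x y} → On x → On y → time x < time y → lt X x y ≡ true
    col-comparable : ∀ {x y} → q x ≡ q y → time x < time y → lt X x y ≡ true

module ExtremalChain {X δ c} (ex : ExtremalLine X δ c) where
  open ExtremalLine ex

  elements = allFin (size X)

  columns⇒q : ∀ ds {r} → r ≤ c → map (col X) ds ≡ map κ (downFrom r) → map q ds ≡ downFrom r
  columns⇒q [] {zero} _ _ = refl
  columns⇒q (d ∷ ds) {suc r} r<c e with e₁ , e₂ ← ∷-injective e =
    cong₂ _∷_ (κ-injective (q<c d) r<c (trans (sym (col≡κq d)) e₁)) (columns⇒q ds (<⇒≤ r<c) e₂)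

  q⇒columns : ∀ ds {r} → map q ds ≡ downFrom r → map (col X) ds ≡ map κ (downFrom r)
  q⇒columns [] {zero} _ = refl
  q⇒columns (d ∷ ds) {suc r} e with e₁ , e₂ ← ∷-injective e =
    cong₂ _∷_ (trans (col≡κq d) (cong κ e₁)) (q⇒columns ds e₂)

  -- Call `x` left of the line if `suc (q x) < g (time x)`, and right of it if `g (time x) < q x`.
  -- If `d` is not left, then right after `d` the line is at level at most `q d`, which is
  -- `suc (q d′)` for the next element; until `d′` the line can only fall.
  not-left : ∀ d ds {r} → map q (d ∷ ds) ≡ downFrom r → isChain X (d ∷ ds) ≡ true →
             g (time d) ≤ suc (q d) → All (λ x → g (time x) ≤ suc (q x)) (d ∷ ds)
  not-left d [] _ _ nl = nl ∷ []
  not-left d (d′ ∷ ds) {suc zero} () _ _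
  not-left d (d′ ∷ ds) {suc (suc r)} e ch nl
    with e₁ , e₂ ← ∷-injective e | l , ch′ ← ∧-true⁻ ch =
    nl ∷ not-left d′ ds e₂ ch′ (≤-trans (g-antitone (lt⇒< l))
      (≤-trans (after (trichotomy d)) (≤-reflexive (trans e₁ (cong suc (sym (proj₁ (∷-injective e₂))))))))
    where
    after : On d ⊎ suc (q d) < g (time d) ⊎ g (time d) < q d → g (suc (time d)) ≤ q d
    after (inj₁ on)        = ≤-reflexive (on-after on)
    after (inj₂ (inj₁ l))  = contradiction nl (<⇒≱ l)
    after (inj₂ (inj₂ r))  = off-after r

  -- Induction from the end of the chain, where `q` is 0. If `d′` is not right of the line, then
  -- `g (time d′)` is at least `suc (q d′)`, which is `q d`, and `g` was no smaller at the time of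
  -- `d`.
  not-right : ∀ ds {r} → map q ds ≡ downFrom r → isChain X ds ≡ true →
              All (λ x → q x ≤ g (time x)) ds
  not-right [] _ _ = []
  not-right (d ∷ []) {suc zero} e _ = ≤-trans (≤-reflexive (proj₁ (∷-injective e))) z≤n ∷ []
  not-right (d ∷ []) {suc (suc r)} e _ with _ , () ← ∷-injective e
  not-right (d ∷ d′ ∷ ds) {suc zero} ()
  not-right (d ∷ d′ ∷ ds) {suc (suc r)} e ch
    = prepend (not-right (d′ ∷ ds) e₂ (proj₂ (∧-true⁻ ch)))
    where
    e₁ = proj₁ (∷-injective e)
    e₂ = proj₂ (∷-injective e)
    next : q d′ ≤ g (time d′) → On d′ ⊎ suc (q d′) < g (time d′) ⊎ g (time d′) < q d′ → suc (q d′) ≤ g (time d′)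
    next nr (inj₁ on)       = ≤-reflexive (sym (on-before on))
    next nr (inj₂ (inj₁ l)) = <⇒≤ l
    next nr (inj₂ (inj₂ r)) = contradiction nr (<⇒≱ r)
    prepend : All (λ x → q x ≤ g (time x)) (d′ ∷ ds) → All (λ x → q x ≤ g (time x)) (d ∷ d′ ∷ ds)
    prepend (nr ∷ nrs) =
      ≤-trans (≤-reflexive (trans e₁ (cong suc (sym (proj₁ (∷-injective e₂))))))
        (≤-trans (next nr (trichotomy d′)) (g-antitone (<⇒≤ (lt⇒< (proj₁ (∧-true⁻ ch)))))) ∷ nr ∷ nrs

  chain-on′ : ∀ ds → map q ds ≡ downFrom c → isChain X ds ≡ true → All On ds
  chain-on′ [] _ _ = []
  chain-on′ (d ∷ ds) e ch = All.zipWith (λ {x} (nl , nr) → on nl nr (trichotomy x))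
    (not-left d ds e ch (≤-trans (g≤c _) (top e)) , not-right (d ∷ ds) e ch)
    where
    -- The chain begins at level `c ∸ 1` and `g` never exceeds `c`, so its first element cannot be
    -- left.
    top : ∀ {k} → map q (d ∷ ds) ≡ downFrom k → k ≤ suc (q d)
    top {suc k} e = s≤s (≤-reflexive (sym (proj₁ (∷-injective e))))
    on : ∀ {x} → g (time x) ≤ suc (q x) → q x ≤ g (time x) → On x ⊎ suc (q x) < g (time x) ⊎ g (time x) < q x →
      On x
    on nl nr (inj₁ o) = o
    on nl nr (inj₂ (inj₁ l)) = contradiction nl (<⇒≱ l)
    on nl nr (inj₂ (inj₂ r)) = contradiction nr (<⇒≱ r)

  on-order : ∀ {x y} → On x → On y → q y < q x → time x < time y
  on-order {x} {y} ox oy l with <-cmp (time x) (time y)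
  ... | tri< t _ _ = t
  ... | tri≈ _ t _ = contradiction (suc-injective (trans (sym (on-before oy)) (trans (cong g (sym t)) (on-before ox)))) (<⇒≢ l)
  ... | tri> _ _ t = contradiction
    (≤-trans (≤-reflexive (sym (on-before ox))) (≤-trans (g-antitone t) (≤-reflexive (on-after oy))))
    (<⇒≱ (m<n⇒m<1+n l))

  on-unique : ∀ {x y} → On x → On y → q x ≡ q y → x ≡ y
  on-unique {x} {y} ox oy e with <-cmp (time x) (time y)
  ... | tri≈ _ t _ = time-inj t
  ... | tri< t _ _ = contradiction
    (≤-trans (≤-reflexive (sym (on-before oy))) (≤-trans (g-antitone t) (≤-reflexive (trans (on-after ox) e)))) (<-irrefl refl)
  ... | tri> _ _ t = contradiction
    (≤-trans (≤-reflexive (sym (on-before ox))) (≤-trans (g-antitone t) (≤-reflexive (trans (on-after oy) (sym e))))) (<-irrefl refl)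

  -- Existence of the chain: one crossing on the line for each level, from the highest down. As the
  -- line falls, this is also their order in time.
  on-list : ∀ r → r ≤ c → List (Fin (size X))
  on-list zero    _ = []
  on-list (suc r) p = proj₁ (on-exists p) ∷ on-list r (<⇒≤ p)

  on-list-q : ∀ r p → map q (on-list r p) ≡ downFrom r
  on-list-q zero    p = refl
  on-list-q (suc r) p = cong₂ _∷_ (proj₂ (proj₂ (on-exists p))) (on-list-q r (<⇒≤ p))

  on-list-chain : ∀ r p → isChain X (on-list r p) ≡ true
  on-list-chain zero          p = refl
  on-list-chain (suc zero)    p = refl
  on-list-chain (suc (suc r)) p with on-exists p | on-exists (<⇒≤ p) | on-list-chain (suc r) (<⇒≤ p)
  ... | x , ox , qx | y , oy , qy | ch =
    ∧-true⁺ (on-comparable ox oy (on-order ox oy (≤-reflexive (trans (cong suc qy) (sym qx))))) ch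

  theChain = chain X δ c

  private
    characterized : map (col X) theChain ≡ colsOf X δ c × isChain X theChain ≡ true
    characterized = chain-characterization X δ c
      (trans (q⇒columns _ (on-list-q c ≤-refl)) (sym columns)) (on-list-chain c ≤-refl)

  chain-q : map q theChain ≡ downFrom c
  chain-q = columns⇒q theChain ≤-refl (trans (proj₁ characterized) columns)

  ∈-chain⇒on : ∀ {x} → x ∈ theChain → On x
  ∈-chain⇒on = All.lookup (chain-on′ theChain chain-q (proj₂ characterized))

  chain-has : ∀ x → ∃ λ d → d ∈ theChain × On d × q d ≡ q x
  chain-has x with d , d∈ , e ← ∈-map⁻ q (subst (q x ∈_) (sym chain-q) (∈-downFrom⁺ (q<c x))) =
    d , d∈ , ∈-chain⇒on d∈ , sym e

  on⇒∈-chain : ∀ {x} → On x → x ∈ theChain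
  on⇒∈-chain {x} ox with d , d∈ , od , e ← chain-has x = subst (_∈ theChain) (on-unique od ox e) d∈

  memb⁻ : ∀ {x} → memb X x theChain ≡ true → On x
  memb⁻ {x} e with d , d∈ , xd ← any-true⁻ (eqF x) theChain e rewrite eqF-true⁻ xd = ∈-chain⇒on d∈

  memb⁺ : ∀ {x} → On x → memb X x theChain ≡ true
  memb⁺ {x} ox = any-true⁺ (eqF x) (on⇒∈-chain ox) (eqF-refl x)

  same-col⇒same-q : ∀ {x y} → (col X x ≡ᵇ col X y) ≡ true → q x ≡ q y
  same-col⇒same-q {x} {y} e =
    κ-injective (q<c x) (q<c y) (trans (sym (col≡κq x)) (trans (≡ᵇ-true⁻ _ _ e) (col≡κq y)))

  same-q⇒same-col : ∀ {x y} → q x ≡ q y → (col X x ≡ᵇ col X y) ≡ true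
  same-q⇒same-col {x} {y} e = ≡ᵇ-true⁺ {col X x} (trans (col≡κq x) (trans (cong κ e) (sym (col≡κq y))))

  inI⁻ : ∀ {x} → inI X δ c x ≡ true → ¬ (g (time x) < q x)
  inI⁻ {x} e r with d , d∈ , p ← any-true⁻ _ theChain e with l , e′ ← ∧-true⁻ p =
    contradiction (≤-trans (≤-reflexive (sym (on-before (∈-chain⇒on d∈)))) (g-antitone (<⇒≤ (lt⇒< l))))
      (<⇒≱ (m<n⇒m<1+n (subst (g (time x) <_) (same-col⇒same-q e′) r)))

  -- From the time of `d` on, the line is at level at most `suc (q d)`; a left element therefore
  -- precedes the chain element of its column.
  inI⁺ : ∀ {x} → suc (q x) < g (time x) → inI X δ c x ≡ true
  inI⁺ {x} l with d , d∈ , od , e ← chain-has x =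
    any-true⁺ _ d∈ (∧-true⁺ (col-comparable (sym e) before) (same-q⇒same-col (sym e)))
    where
    before : time x < time d
    before = ≰⇒> λ t → <-irrefl refl (<-≤-trans l (≤-trans (later t) (≤-reflexive (cong suc e))))
      where
      later : time d ≤ time x → g (time x) ≤ suc (q d)
      later t = ≤-trans (g-antitone t) (≤-reflexive (on-before od))

  -- The elements that `ind` counts, in one list: comparing two diagrams later requires the elements
  -- themselves and not only their number.
  rightOf : List (Fin (size X))
  rightOf = concat (map (λ d → filterᵇ (λ k → lt X d k ∧ (col X k ≡ᵇ col X d)) elements) theChain)

  ind≡length-rightOf : ind X δ c ≡ length rightOf
  ind≡length-rightOf = sym (trans (length-concat (map (λ d → filterᵇ (λ k → lt X d k ∧ (col X k ≡ᵇ col X d)) elements) theChain)) (cong sum (sym (map-∘ theChain))))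

  rightOf-unique : Unique rightOf
  rightOf-unique = Uniqueₚ.concat⁺
    (Allₚ.map⁺ (All.tabulate λ _ → Uniqueₚ.filter⁺ _ (Uniqueₚ.allFin⁺ _)))
    (AllPairsₚ.map⁺ (AllPairs.map disjoint (AllPairsₚ.map⁻ (subst Unique (sym chain-q) (Uniqueₚ.downFrom⁺ c)))))
    where
    disjoint : ∀ {d d′} → q d ≢ q d′ → ∀ {k} →
      ¬ (k ∈ filterᵇ (λ k → lt X d k ∧ (col X k ≡ᵇ col X d)) elements ×
         k ∈ filterᵇ (λ k → lt X d′ k ∧ (col X k ≡ᵇ col X d′)) elements)
    disjoint ne (i , j) = ne (trans
      (sym (same-col⇒same-q (proj₂ (∧-true⁻ (proj₂ (∈-filterᵇ⁻ _ elements i))))))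
      (same-col⇒same-q (proj₂ (∧-true⁻ (proj₂ (∈-filterᵇ⁻ _ elements j))))))

  ∈-rightOf⁻ : ∀ {x} → x ∈ rightOf → g (time x) < q x
  ∈-rightOf⁻ {x} x∈
    with _ , x∈′ , ∈m ← ∈-concat⁻′ (map (λ d → filterᵇ (λ k → lt X d k ∧ (col X k ≡ᵇ col X d)) elements) theChain) x∈
    with d , d∈ , refl ← ∈-map⁻ _ ∈m
    with l , e ← ∧-true⁻ (proj₂ (∈-filterᵇ⁻ _ elements x∈′))
    = right (trichotomy x)
    where
    g≤q : g (time x) ≤ q x
    g≤q = ≤-trans (g-antitone (lt⇒< l)) (≤-reflexive (trans (on-after (∈-chain⇒on d∈)) (sym (same-col⇒same-q e))))
    right : On x ⊎ suc (q x) < g (time x) ⊎ g (time x) < q x → g (time x) < q x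
    right (inj₁ on) = contradiction (≤-trans (≤-reflexive (sym (on-before on))) g≤q) (<-irrefl refl)
    right (inj₂ (inj₁ l)) = contradiction g≤q (<⇒≱ (<⇒≤ l))
    right (inj₂ (inj₂ r)) = r

  ∈-rightOf⁺ : ∀ {x} → g (time x) < q x → x ∈ rightOf
  ∈-rightOf⁺ {x} r with d , d∈ , od , e ← chain-has x =
    ∈-concat⁺′ (∈-filterᵇ⁺ _ (∈-allFin x) (∧-true⁺ (col-comparable e after) (same-q⇒same-col (sym e)))) (∈-map⁺ _ d∈)
    where
    after : time d < time x
    after = ≰⇒> λ t → <-irrefl refl (<-trans r (≤-trans (≤-reflexive (cong suc (sym e)))
      (≤-trans (≤-reflexive (sym (on-before od))) (g-antitone t))))

-- Contraction as deletion of an extremal line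

lookup-injective : ∀ {A : Set} {xs : List A} → Unique xs → ∀ {i j} → lookup xs i ≡ lookup xs j → i ≡ j
lookup-injective (_ ∷ _) {Fin.zero} {Fin.zero} e = refl
lookup-injective (x∉ ∷ u) {Fin.zero} {Fin.suc j} e = contradiction e (All.lookup x∉ (∈-lookup j))
lookup-injective (x∉ ∷ u) {Fin.suc i} {Fin.zero} e = contradiction (sym e) (All.lookup x∉ (∈-lookup i))
lookup-injective (x∉ ∷ u) {Fin.suc i} {Fin.suc j} e = cong Fin.suc (lookup-injective u e)

count-not : ∀ {X : Set} (p : X → Bool) xs → count p xs + count (not ∘ p) xs ≡ length xs
count-not p [] = refl
count-not p (x ∷ xs) with p x
... | true  = cong suc (count-not p xs)
... | false = trans (+-suc _ _) (cong suc (count-not p xs))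

applyUpTo≡applyDownFrom : ∀ {A : Set} (f h : ℕ → A) n → (∀ {i} → i < n → f i ≡ h (n ∸ suc i)) →
                          applyUpTo f n ≡ applyDownFrom h n
applyUpTo≡applyDownFrom f h zero    e = refl
applyUpTo≡applyDownFrom f h (suc n) e =
  cong₂ _∷_ (e (s≤s z≤n)) (applyUpTo≡applyDownFrom (f ∘ suc) h n λ i<n → e (s≤s i<n))

-- What contraction and reconstruction use of an order on crossings. `R-share` is the substantial
-- axiom. Contracted posets keep the order `R` of the original word, so the axioms need to be proved
-- only once for each word.
record CrossingOrder {m} (arr : Arrangement m) (R : Fin m → Fin m → Bool) : Set where
  open Arrangement arr
  open ArrangementProperties arr
  field
    R-refl  : ∀ {s} → R s s ≡ true
    R-trans : ∀ {r s t} → R r s ≡ true → R s t ≡ true → R r t ≡ true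
    R-sound : ∀ {s t} → R s t ≡ true → toℕ s ≤ toℕ t
    R-share : ∀ {s t u} → On u s → On u t → toℕ s < toℕ t → R s t ≡ true

mirror-order : ∀ {m} {arr : Arrangement m} {R} → CrossingOrder arr R → CrossingOrder (mirror arr) R
mirror-order o = record { R-refl = R-refl ; R-trans = R-trans ; R-sound = R-sound
                        ; R-share = λ us ut → R-share (Sum.swap us) (Sum.swap ut) }
  where open CrossingOrder o

record Embedded {m} (arr : Arrangement m) (R : Fin m → Fin m → Bool) (ls : List ℕ) (X : WordPoset) : Set where
  open Arrangement arr
  field
    emb     : Fin (size X) → Fin m
    emb-inj : ∀ {x y} → emb x ≡ emb y → x ≡ y
    inside  : ∀ x → lo (emb x) ∈ ls × hi (emb x) ∈ ls
    onto    : ∀ {s} → lo s ∈ ls → hi s ∈ ls → ∃ λ x → emb x ≡ s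
    le≡R    : ∀ x y → le X x y ≡ R (emb x) (emb y)

mirror-embedded : ∀ {m} {arr : Arrangement m} {R ls X} → Embedded arr R ls X → Embedded (mirror arr) R ls X
mirror-embedded e = record { emb = emb ; emb-inj = emb-inj ; inside = λ x → Product.swap (inside x)
                           ; onto = λ l h → onto h l ; le≡R = le≡R }
  where open Embedded e

unmirror-embedded : ∀ {m} (arr : Arrangement m) {R ls X} → Embedded (mirror arr) R ls X → Embedded arr R ls X
unmirror-embedded arr e = record { emb = emb ; emb-inj = emb-inj ; inside = λ x → Product.swap (inside x)
                                 ; onto = λ l h → onto h l ; le≡R = le≡R }
  where open Embedded e

-- Serves both directions. `L` starts above all lines of `ls`, which for `A` is achieved by
-- mirroring. `κ` converts levels to columns: it is `suc` for `D` and subtraction from `length ls`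
-- for `A`.
module Contraction {m} (arr : Arrangement m) {R} (order : CrossingOrder arr R)
  (L : ℕ) (ls : List ℕ) (unique : Unique (L ∷ ls))
  (lines : ∀ {u} → u ∈ L ∷ ls → Arrangement.Line arr u)
  (top : ∀ {v} → v ∈ ls → Arrangement.below arr 0 v L ≡ true)
  {X} (embedded : Embedded arr R (L ∷ ls) X)
  (δ : Dir) (κ : ℕ → ℕ)
  (κ-injective : ∀ {i j} → i < length ls → j < length ls → κ i ≡ κ j → i ≡ j)
  (columns : colsOf X δ (length ls) ≡ map κ (downFrom (length ls)))
  (col≡κ : ∀ x → col X x ≡ κ (Levels.level arr (L ∷ ls) unique (toℕ (Embedded.emb embedded x))
                                                     (Arrangement.lo arr (Embedded.emb embedded x))))
  where
  open Arrangement arr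
  open ArrangementProperties arr
  open Levels arr (L ∷ ls) unique
  open CrossingOrder order
  open Embedded embedded

  c = length ls

  L∈ : L ∈ L ∷ ls
  L∈ = here refl

  L∉ls : L ∉ ls
  L∉ls = Uniqueₚ.Unique[x∷xs]⇒x∉xs unique

  ≢L⇒∈ : ∀ {u} → u ∈ L ∷ ls → u ≢ L → u ∈ ls
  ≢L⇒∈ (here e)  ne = contradiction e ne
  ≢L⇒∈ (there i) ne = i

  level≤c : ∀ t {u} → u ∈ L ∷ ls → level t u ≤ c
  level≤c t {u} u∈ = ≤-pred (subst (level t u <_) (count-all (λ _ → true) {L ∷ ls} (λ _ → refl))
    (count-< {p = λ v → below t v u} {q = λ _ → true} (λ _ → refl) u∈ (below-irr t u) refl))

  -- `L` starts on top and meets each line at most once, so it is the upper line whenever it crosses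
  -- a line of `ls`.
  not-lo : ∀ {s} → Inside s → lo s ≢ L
  not-lo {s} (_ , h∈) refl with () ← trans (sym (top (≢L⇒∈ h∈ (lo≢hi s ∘ sym))))
    (trans (below-before (inj₂ (refl , refl)) z≤n) (below-hilo s))

  g : ℕ → ℕ
  g t = level t L

  g-step : ∀ s → g (suc (toℕ s)) ≡ g (toℕ s) ⊎ (Inside s × L ≡ hi s)
  g-step s with lo s ∈? (L ∷ ls) | hi s ∈? (L ∷ ls)
    where
    open import Data.List.Membership.DecPropositional _≟_ using (_∈?_)
  ... | no l∉  | _      = inj₁ (level-outside (l∉ ∘ proj₁) L∈)
  ... | yes _  | no h∉  = inj₁ (level-outside (h∉ ∘ proj₂) L∈)
  ... | yes l∈ | yes h∈ with L ≟ hi s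
  ...   | yes e = inj₂ ((l∈ , h∈) , e)
  ...   | no ne = inj₁ (level-not-on λ { (inj₁ e) → not-lo (l∈ , h∈) (sym e) ; (inj₂ e) → ne e })

  g-before : ∀ {s} → Inside s → L ≡ hi s → g (toℕ s) ≡ suc (level (toℕ s) (lo s))
  g-before i refl = level-hi i

  g-after : ∀ {s} → L ≡ hi s → g (suc (toℕ s)) ≡ level (toℕ s) (lo s)
  g-after refl = level-hi-after

  g-step-≤ : ∀ s → g (suc (toℕ s)) ≤ g (toℕ s)
  g-step-≤ s with g-step s
  ... | inj₁ e       = ≤-reflexive e
  ... | inj₂ (i , e) = ≤-trans (≤-reflexive (g-after e)) (≤-trans (n≤1+n _) (≤-reflexive (sym (g-before i e))))

  g-antitone : ∀ {i j} → i ≤ j → j ≤ m → g j ≤ g i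
  g-antitone {i} {zero} z≤n _ = ≤-refl
  g-antitone {i} {suc j} i≤j j<m with m≤n⇒m<n∨m≡n i≤j
  ... | inj₂ refl = ≤-refl
  ... | inj₁ (s≤s i≤j′) = ≤-trans
    (subst (λ k → g (suc k) ≤ g k) (toℕ-fromℕ< j<m) (g-step-≤ (fromℕ< j<m)))
    (g-antitone i≤j′ (<⇒≤ j<m))

  time : Fin (size X) → ℕ
  time x = toℕ (emb x)

  q : Fin (size X) → ℕ
  q x = level (time x) (lo (emb x))

  OnL : Fin (size X) → Set
  OnL x = L ≡ hi (emb x)

  not-on : ∀ {x} → ¬ OnL x → ¬ On L (emb x)
  not-on {x} ¬on (inj₁ e) = not-lo (inside x) (sym e)
  not-on {x} ¬on (inj₂ e) = ¬on e

  trichotomy : ∀ x → OnL x ⊎ suc (q x) < g (time x) ⊎ g (time x) < q x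
  trichotomy x with L ≟ hi (emb x)
  ... | yes e = inj₁ e
  ... | no ne with <-cmp (g (time x)) (q x)
  ...   | tri< l _ _ = inj₂ (inj₂ l)
  ...   | tri≈ _ e _ = contradiction (sym (level-injective L∈ (proj₁ (inside x)) e)) (not-lo (inside x))
  ...   | tri> _ _ l with m≤n⇒m<n∨m≡n l
  ...     | inj₁ l′ = inj₂ (inj₁ l′)
  ...     | inj₂ e  = contradiction (level-injective L∈ (proj₂ (inside x)) (trans (sym e) (sym (level-hi (inside x))))) ne

  g0 : g 0 ≡ c
  g0 = trans (count-∷-false (λ v → below 0 v L) (below-irr 0 L)) (count-all _ top)

  -- The final order is the reverse of the initial one, so `L` ends below all lines of `ls`.
  gm : g m ≡ 0
  gm = trans (count-∷-false (λ v → below m v L) (below-irr m L)) (count-none _ λ {v} v∈ →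
    let v≢L = λ e → L∉ls (subst (_∈ ls) e v∈) in
    trans (final (lines (there v∈)) (lines (here refl)) v≢L) (trans (below-flip 0 (v≢L ∘ sym)) (cong not (top v∈))))

  -- Discrete intermediate value: the step at which `g` drops to `r` or less is a crossing on `L`,
  -- and since it lowers `g` by just one, it lies at level `r`.
  on-exists′ : ∀ {r} → r < c → ∀ j → j ≤ m → g j ≤ r → ∃ λ x → OnL x × q x ≡ r
  on-exists′ r<c zero j≤m l = contradiction (subst (_≤ _) g0 l) (<⇒≱ r<c)
  on-exists′ {r} r<c (suc j) j<m l with g j ≤? r
  ... | yes l′ = on-exists′ r<c j (<⇒≤ j<m) l′
  ... | no ¬l′ = by (g-step s)
    where
    s = fromℕ< j<m
    gs> : r < g (toℕ s)
    gs> = subst (λ k → r < g k) (sym (toℕ-fromℕ< j<m)) (≰⇒> ¬l′)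
    gs≤ : g (suc (toℕ s)) ≤ r
    gs≤ = subst (λ k → g (suc k) ≤ r) (sym (toℕ-fromℕ< j<m)) l
    by : g (suc (toℕ s)) ≡ g (toℕ s) ⊎ (Inside s × L ≡ hi s) → ∃ λ x → OnL x × q x ≡ r
    by (inj₁ e) = contradiction (subst (_≤ r) e gs≤) (<⇒≱ gs>)
    by (inj₂ (i , e)) with x , eq ← onto (proj₁ i) (proj₂ i) =
      x , trans e (cong hi (sym eq)) ,
      trans (cong (λ s → level (toℕ s) (lo s)) eq)
        (≤-antisym (subst (_≤ r) (g-after e) gs≤) (≤-pred (subst (r <_) (g-before i e) gs>)))

  R⇒lt : ∀ {x y} → R (emb x) (emb y) ≡ true → time x < time y → lt X x y ≡ true
  R⇒lt {x} {y} e t = ∧-true⁺ (trans (le≡R x y) e)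
    (cong not (eqF-≢ λ { refl → <-irrefl refl t }))

  lt⇒< : ∀ {x y} → lt X x y ≡ true → time x < time y
  lt⇒< {x} {y} e with a , b ← ∧-true⁻ {le X x y} e =
    ≤∧≢⇒< (R-sound (trans (sym (le≡R x y)) a)) λ t → x≢y b (emb-inj (toℕ-injective t))
    where
    x≢y : not (eqF x y) ≡ true → x ≢ y
    x≢y b refl with () ← trans (sym b) (cong not (eqF-refl x))

  extremal : ExtremalLine X δ c
  extremal = record
    { κ = κ ; κ-injective = κ-injective ; columns = columns ; q = q
    ; q<c = λ x → ≤-trans (≤-reflexive (sym (level-hi (inside x)))) (level≤c _ (proj₂ (inside x)))
    ; col≡κq = col≡κ ; time = time ; time-inj = λ e → emb-inj (toℕ-injective e)
    ; lt⇒< = lt⇒< ; g = g ; g≤c = λ t → level≤c t L∈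
    ; g-antitone = λ {x} l → g-antitone l (<⇒≤ (toℕ<n (emb x)))
    ; On = OnL ; on-before = λ {x} e → g-before (inside x) e ; on-after = g-after
    ; off-after = λ {x} l → ≤-trans (g-step-≤ (emb x)) (<⇒≤ l)
    ; trichotomy = trichotomy
    ; on-exists = λ r<c → on-exists′ r<c m ≤-refl (≤-trans (≤-reflexive gm) z≤n)
    ; on-comparable = λ ox oy t → R⇒lt (R-share (inj₂ ox) (inj₂ oy) t) t
    -- Crossings at one level need not share a line; they are linked through the lines that occupy
    -- this level in between.
    ; col-comparable = λ {x} {y} e t → R⇒lt
        (same-level⇒≼ (λ s t → R s t ≡ true) R-refl R-trans R-share (inside x) (inside y) (inj₁ refl) (inj₁ refl) e t) t
    }

  open ExtremalChain extremal public

  left⇒below : ∀ {x} → suc (q x) < g (time x) → below (time x) L (lo (emb x)) ≡ false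
  left⇒below {x} l = trans (below-flip _ (not-lo (inside x) ∘ sym)) (cong not (level-<⁻ L∈ (<-trans (n<1+n _) l)))

  right⇒below : ∀ {x} → g (time x) < q x → below (time x) L (lo (emb x)) ≡ true
  right⇒below {x} l = level-<⁻ (proj₁ (inside x)) l

  below⇒right : ∀ {x} → below (time x) L (lo (emb x)) ≡ true → g (time x) < q x
  below⇒right {x} b = level-< L∈ b

  -- Membership in `I` records on which side of `x` the deleted line runs. Hence the column shift of
  -- `contract` equals the change in the number of lines below.
  inI-below : ∀ x → ¬ OnL x → inI X δ c x ≡ not (below (time x) L (lo (emb x)))
  inI-below x ¬on with trichotomy x
  ... | inj₁ on       = contradiction on ¬on
  ... | inj₂ (inj₁ l) = trans (inI⁺ l) (cong not (sym (left⇒below l)))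
  ... | inj₂ (inj₂ r) with inI X δ c x in e
  ...   | true  = contradiction r (inI⁻ e)
  ...   | false = cong not (sym (right⇒below r))

  rest : List (Fin (size X))
  rest = filterᵇ (λ x → not (memb X x (chain X δ c))) (allFin (size X))

  ∈-rest⁻ : ∀ {x} → x ∈ rest → ¬ OnL x
  ∈-rest⁻ x∈ on with () ← trans (sym (proj₂ (∈-filterᵇ⁻ _ (allFin (size X)) x∈))) (cong not (memb⁺ on))

  ∈-rest⁺ : ∀ {x} → ¬ OnL x → x ∈ rest
  ∈-rest⁺ {x} ¬on = ∈-filterᵇ⁺ _ (∈-allFin x) (not-memb (memb X x (chain X δ c)) refl)
    where
    not-memb : ∀ b → memb X x (chain X δ c) ≡ b → not b ≡ true
    not-memb false _ = refl
    not-memb true  e = contradiction (memb⁻ e) ¬on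

  off-inside : ∀ {x} → ¬ OnL x → lo (emb x) ∈ ls × hi (emb x) ∈ ls
  off-inside {x} ¬on =
    ≢L⇒∈ (proj₁ (inside x)) (not-lo (inside x)) , ≢L⇒∈ (proj₂ (inside x)) (¬on ∘ sym)

  contract-embedded : Embedded arr R ls (contract X δ c)
  contract-embedded = record
    { emb = λ j → emb (lookup rest j)
    ; emb-inj = λ e → lookup-injective (Uniqueₚ.filter⁺ _ (Uniqueₚ.allFin⁺ (size X))) (emb-inj e)
    ; inside = λ j → off-inside (∈-rest⁻ (∈-lookup j))
    ; onto = λ l h → onto-rest l h (onto (there l) (there h))
    ; le≡R = λ x y → le≡R _ _
    }
    where
    onto-rest : ∀ {s} → lo s ∈ ls → hi s ∈ ls → (∃ λ x → emb x ≡ s) → ∃ λ j → emb (lookup rest j) ≡ s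
    onto-rest {s} l h (x , e) =
      let x∈ = ∈-rest⁺ λ on → L∉ls (subst (_∈ ls) (trans (cong hi (sym e)) (sym on)) h)
      in Any.index x∈ , trans (cong emb (sym (Anyₚ.lookup-index x∈))) e

-- Columns are added to `Embedded` only here, because their formula counts the lines below a
-- crossing and is not preserved by `mirror`.
record Model {m} (arr : Arrangement m) (R : Fin m → Fin m → Bool) (ls : List ℕ) (X : WordPoset) : Set where
  open Arrangement arr
  field
    embedded : Embedded arr R ls X
  open Embedded embedded public
  field
    col≡ : ∀ x → col X x ≡ suc (count (λ v → below (toℕ (emb x)) v (lo (emb x))) ls)

model-↭ : ∀ {m} {arr : Arrangement m} {R ls ls′ X} → ls ↭ ls′ → Model arr R ls X → Model arr R ls′ X
model-↭ p M = record
  { embedded = record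
    { emb = emb ; emb-inj = emb-inj
    ; inside = λ x → ∈-resp-↭ p (proj₁ (inside x)) , ∈-resp-↭ p (proj₂ (inside x))
    ; onto = λ l h → onto (∈-resp-↭ (↭-sym p) l) (∈-resp-↭ (↭-sym p) h) ; le≡R = le≡R }
  ; col≡ = λ x → trans (col≡ x) (cong suc (count-↭ _ p)) }
  where open Model M

module _ {m} (arr : Arrangement m) {R} (order : CrossingOrder arr R)
  (L : ℕ) (ls : List ℕ) (unique : Unique (L ∷ ls))
  (lines : ∀ {u} → u ∈ L ∷ ls → Arrangement.Line arr u)
  {X} (model : Model arr R (L ∷ ls) X) where
  open Arrangement arr
  open ArrangementProperties arr
  open Model model

  module ContractD (top : ∀ {v} → v ∈ ls → below 0 v L ≡ true) where

    open Contraction arr order L ls unique lines top embedded D suc (λ _ _ → suc-injective) refl col≡ public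

    contract-model : Model arr R ls (contract X D (length ls))
    contract-model = record { embedded = contract-embedded ; col≡ = λ j → col-rest (lookup rest j) (∈-rest⁻ (∈-lookup j)) }
      where
      col-rest : ∀ x → ¬ OnL x → (if inI X D c x then col X x else col X x ∸ 1) ≡
                 suc (count (λ v → below (time x) v (lo (emb x))) ls)
      col-rest x ¬on with inI X D c x | below (time x) L (lo (emb x)) in b | inI-below x ¬on
      ... | .true  | false | refl = trans (col≡ x) (cong suc (count-∷-false (λ v → below (time x) v (lo (emb x))) b))
      ... | .false | true  | refl = trans (cong (_∸ 1) (col≡ x)) (count-∷-true (λ v → below (time x) v (lo (emb x))) b)

    -- Naming crossings by their two lines makes lists from different words comparable.
    rightPairs : List (ℕ × ℕ)
    rightPairs = map (λ x → lo (emb x) , hi (emb x)) rightOf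

    ind≡length-rightPairs : ind X D c ≡ length rightPairs
    ind≡length-rightPairs = trans ind≡length-rightOf (sym (length-map _ rightOf))

    rightPairs-unique : Unique rightPairs
    rightPairs-unique = Uniqueₚ.map⁺
      (λ e → emb-inj (once _ _ (inj₁ (cong proj₁ e , cong proj₂ e)))) rightOf-unique

    ∈-rightPairs⁻ : ∀ {u v} → (u , v) ∈ rightPairs →
      ∃ λ s → lo s ≡ u × hi s ≡ v × u ∈ ls × v ∈ ls × below (toℕ s) L u ≡ true
    ∈-rightPairs⁻ uv∈ with x , x∈ , refl ← ∈-map⁻ _ uv∈ =
      let r = ∈-rightOf⁻ x∈
          l∈ , h∈ = off-inside λ on → <-asym r (≤-trans (n<1+n _) (≤-reflexive (sym (g-before (inside x) on))))
      in emb x , refl , refl , l∈ , h∈ , right⇒below r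

    ∈-rightPairs⁺ : ∀ {s} → lo s ∈ ls → hi s ∈ ls → below (toℕ s) L (lo s) ≡ true → (lo s , hi s) ∈ rightPairs
    ∈-rightPairs⁺ l∈ h∈ b with x , refl ← onto (there l∈) (there h∈) = ∈-map⁺ _ (∈-rightOf⁺ (below⇒right b))

  module ContractA (bottom : ∀ {v} → v ∈ ls → below 0 L v ≡ true) where

    open Levels arr (L ∷ ls) unique using (level; level-hi)

    -- The columns seen from the other side: q lines below and q′ above a crossing, c + 1 in all.
    levels-complementary : ∀ x → let t = toℕ (emb x) in
      suc (level t (lo (emb x))) + count (λ v → below t (hi (emb x)) v) (L ∷ ls) ≡ length ls
    levels-complementary x = suc-injective (begin
      suc (suc (level t (lo s)) + above)                      ≡⟨ cong (λ k → suc (k + above)) (sym (level-hi (inside x))) ⟩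
      suc (level t (hi s) + above)                            ≡⟨ sym (+-suc (level t (hi s)) above) ⟩
      level t (hi s) + suc above                              ≡⟨ cong (level t (hi s) +_) (sym not-below) ⟩
      level t (hi s) + count (λ v → not (below t v (hi s))) (L ∷ ls) ≡⟨ count-not (λ v → below t v (hi s)) (L ∷ ls) ⟩
      suc (length ls)                                         ∎)
      where
      open ≡-Reasoning
      s = emb x
      t = toℕ s
      above = count (λ v → below t (hi s) v) (L ∷ ls)
      not-below : count (λ v → not (below t v (hi s))) (L ∷ ls) ≡ suc above
      not-below = count-single unique (proj₂ (inside x)) (cong not (below-irr t (hi s))) (below-irr t (hi s))
        λ _ ne → sym (below-flip t (ne ∘ sym))

    -- Counted from above, level `q′` is column `c ∸ q′`, so the ascending columns of `A` are again
    -- a descending list of levels.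
    columns-A : ∀ c → map suc (upTo c) ≡ map (c ∸_) (downFrom c)
    columns-A c = trans (map-upTo suc c)
      (trans (applyUpTo≡applyDownFrom suc (c ∸_) c λ i<c → sym (m∸[m∸n]≡n i<c)) (sym (map-downFrom (c ∸_) c)))

    col≡κ : ∀ x → col X x ≡ length ls ∸ count (λ v → below (toℕ (emb x)) (hi (emb x)) v) (L ∷ ls)
    col≡κ x = trans (col≡ x) (sym (trans (cong (_∸ above) (sym (levels-complementary x))) (m+n∸n≡m _ above)))
      where above = count (λ v → below (toℕ (emb x)) (hi (emb x)) v) (L ∷ ls)

    open Contraction (mirror arr) (mirror-order order) L ls unique lines bottom (mirror-embedded embedded) A
      (length ls ∸_) (λ i<c j<c → ∸-cancelˡ-≡ (<⇒≤ i<c) (<⇒≤ j<c)) (columns-A (length ls)) col≡κ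

    contract-model : Model arr R ls (contract X A (length ls))
    contract-model = record { embedded = unmirror-embedded arr contract-embedded ; col≡ = λ j → col-rest (lookup rest j) (∈-rest⁻ (∈-lookup j)) }
      where
      -- The mirrored diagram gives the position of `L` relative to `hi`, while the column formula
      -- needs it relative to `lo`; a line off the crossing lies on the same side of both.
      flipped : ∀ x → ¬ OnL x → below (time x) L (lo (emb x)) ≡ not (below (time x) (hi (emb x)) L)
      flipped x ¬on = trans (below-adj (emb x) (not-lo′ ∘ inj₂) (not-lo′ ∘ inj₁)) (below-flip _ (not-lo′ ∘ inj₁))
        where
        not-lo′ : ¬ (L ≡ hi (emb x) ⊎ L ≡ lo (emb x))
        not-lo′ = not-on ¬on
      col-rest : ∀ x → ¬ OnL x → (if inI X A c x then col X x ∸ 1 else col X x) ≡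
                 suc (count (λ v → below (time x) v (lo (emb x))) ls)
      col-rest x ¬on with inI X A c x | below (time x) (hi (emb x)) L | inI-below x ¬on | flipped x ¬on
      ... | .true  | false | refl | b = trans (cong (_∸ 1) (col≡ x)) (count-∷-true (λ v → below (time x) v (lo (emb x))) b)
      ... | .false | true  | refl | b = trans (col≡ x) (cong suc (count-∷-false (λ v → below (time x) v (lo (emb x))) b))

-- Transpositions and the deletion condition

transpose : ℕ → ℕ → ℕ → ℕ
transpose p q x = if x ≡ᵇ p then q else (if x ≡ᵇ q then p else x)

transpose-spec : ∀ p q x → (x ≡ p × transpose p q x ≡ q) ⊎ (x ≢ p × x ≡ q × transpose p q x ≡ p) ⊎
                 (x ≢ p × x ≢ q × transpose p q x ≡ x)
transpose-spec p q x with x ≡ᵇ p in ep | x ≡ᵇ q in eq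
... | true  | _     = inj₁ (≡ᵇ-true⁻ x p ep , refl)
... | false | true  = inj₂ (inj₁ ((λ e → Boolₚ.not-¬ ep (≡ᵇ-true⁺ e)) , ≡ᵇ-true⁻ x q eq , refl))
... | false | false = inj₂ (inj₂ ((λ e → Boolₚ.not-¬ ep (≡ᵇ-true⁺ e)) , (λ e → Boolₚ.not-¬ eq (≡ᵇ-true⁺ e)) , refl))

transpose-left : ∀ p q → transpose p q p ≡ q
transpose-left p q with transpose-spec p q p
... | inj₁ (_ , e)            = e
... | inj₂ (inj₁ (ne , _))    = contradiction refl ne
... | inj₂ (inj₂ (ne , _))    = contradiction refl ne

transpose-right : ∀ p q → transpose p q q ≡ p
transpose-right p q with transpose-spec p q q
... | inj₁ (e , e′)           = trans e′ e
... | inj₂ (inj₁ (_ , _ , e)) = e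
... | inj₂ (inj₂ (_ , ne , _)) = contradiction refl ne

transpose-other : ∀ {p q x} → x ≢ p → x ≢ q → transpose p q x ≡ x
transpose-other {p} {q} {x} a b with transpose-spec p q x
... | inj₁ (e , _)            = contradiction e a
... | inj₂ (inj₁ (_ , e , _)) = contradiction e b
... | inj₂ (inj₂ (_ , _ , e)) = e

transpose-sym : ∀ p q x → transpose p q x ≡ transpose q p x
transpose-sym p q x with transpose-spec p q x
... | inj₁ (refl , e)             = trans e (sym (transpose-right q p))
... | inj₂ (inj₁ (_ , refl , e))  = trans e (sym (transpose-left q p))
... | inj₂ (inj₂ (a , b , e))     = trans e (sym (transpose-other b a))

transpose-conj : ∀ {f : ℕ → ℕ} → (∀ {x y} → f x ≡ f y → x ≡ y) → ∀ p q x →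
                 f (transpose p q x) ≡ transpose (f p) (f q) (f x)
transpose-conj {f} inj p q x with transpose-spec p q x
... | inj₁ (refl , e)             = trans (cong f e) (sym (transpose-left (f p) (f q)))
... | inj₂ (inj₁ (_ , refl , e))  = trans (cong f e) (sym (transpose-right (f p) (f q)))
... | inj₂ (inj₂ (a , b , e))     = trans (cong f e) (sym (transpose-other (a ∘ inj) (b ∘ inj)))

transpose-involutive : ∀ p q x → transpose p q (transpose p q x) ≡ x
transpose-involutive p q x with transpose-spec p q x
... | inj₁ (refl , e)             = trans (cong (transpose p q) e) (transpose-right p q)
... | inj₂ (inj₁ (_ , refl , e))  = trans (cong (transpose p q) e) (transpose-left p q)
... | inj₂ (inj₂ (a , b , e))     = trans (cong (transpose p q) e) e

-- `sw a` unfolds to `transpose a (suc a)`. General transpositions arise because deleting a letter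
-- exchanges two lines whose labels need not be consecutive.
sw-involutive : ∀ a x → sw a (sw a x) ≡ x
sw-involutive a = transpose-involutive a (suc a)

sw-injective : ∀ a {x y} → sw a x ≡ sw a y → x ≡ y
sw-injective a {x} {y} e = trans (sym (sw-involutive a x)) (trans (cong (sw a) e) (sw-involutive a y))

sw-< : ∀ a {x y} → x < y → ¬ (x ≡ a × y ≡ suc a) → sw a x < sw a y
sw-< a {x} {y} l ne with transpose-spec a (suc a) x | transpose-spec a (suc a) y
... | inj₁ (refl , e) | inj₁ (refl , e′) = contradiction l (<-irrefl refl)
... | inj₁ (refl , e) | inj₂ (inj₁ (_ , refl , e′)) = contradiction (refl , refl) ne
... | inj₁ (refl , e) | inj₂ (inj₂ (_ , b , e′)) rewrite e | e′ = ≤∧≢⇒< l (b ∘ sym)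
... | inj₂ (inj₁ (_ , refl , e)) | inj₁ (refl , e′) = contradiction l (<-asym (n<1+n a))
... | inj₂ (inj₁ (_ , refl , e)) | inj₂ (inj₁ (_ , refl , e′)) = contradiction l (<-irrefl refl)
... | inj₂ (inj₁ (_ , refl , e)) | inj₂ (inj₂ (_ , _ , e′)) rewrite e | e′ = <-trans (n<1+n a) l
... | inj₂ (inj₂ (_ , _ , e)) | inj₁ (refl , e′) rewrite e | e′ = m<n⇒m<1+n l
... | inj₂ (inj₂ (a≢ , _ , e)) | inj₂ (inj₁ (_ , refl , e′)) rewrite e | e′ = ≤∧≢⇒< (≤-pred l) a≢
... | inj₂ (inj₂ (_ , _ , e)) | inj₂ (inj₂ (_ , _ , e′)) rewrite e | e′ = l

sw-<ᵇ : ∀ a {x y} → ¬ (x ≡ a × y ≡ suc a) → ¬ (x ≡ suc a × y ≡ a) → (sw a x <ᵇ sw a y) ≡ (x <ᵇ y)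
sw-<ᵇ a {x} {y} ne ne′ = true⇔⇒≡
  (λ b → <ᵇ-true⁺ (subst₂ _<_ (sw-involutive a x) (sw-involutive a y) (sw-< a (<ᵇ-true⁻ (sw a x) (sw a y) b)
    λ (ex , ey) → ne′ (trans (sym (sw-involutive a x)) (trans (cong (sw a) ex) (transpose-left a (suc a))) ,
                       trans (sym (sw-involutive a y)) (trans (cong (sw a) ey) (transpose-right a (suc a)))))))
  (λ b → <ᵇ-true⁺ (sw-< a (<ᵇ-true⁻ x y b) ne))

<ᵇ-irrefl : ∀ x → (x <ᵇ x) ≡ false
<ᵇ-irrefl zero    = refl
<ᵇ-irrefl (suc x) = <ᵇ-irrefl x

<ᵇ-flip : ∀ {x y} → x ≢ y → (x <ᵇ y) ≡ not (y <ᵇ x)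
<ᵇ-flip {zero}  {zero}  ne = contradiction refl ne
<ᵇ-flip {zero}  {suc y} ne = refl
<ᵇ-flip {suc x} {zero}  ne = refl
<ᵇ-flip {suc x} {suc y} ne = <ᵇ-flip (ne ∘ cong suc)

<ᵇ-suc : ∀ {x y} → x ≢ y → (x <ᵇ y) ≡ (x <ᵇ suc y)
<ᵇ-suc {x} {y} ne = true⇔⇒≡ (λ b → <ᵇ-true⁺ (m<n⇒m<1+n (<ᵇ-true⁻ x y b)))
  (λ b → <ᵇ-true⁺ (≤∧≢⇒< (≤-pred (<ᵇ-true⁻ x (suc y) b)) ne))

∸-<ᵇ : ∀ {k x y} → x ≤ k → y ≤ k → (k ∸ x <ᵇ k ∸ y) ≡ (y <ᵇ x)
∸-<ᵇ {k} {x} {y} x≤k y≤k = true⇔⇒≡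
  (λ b → <ᵇ-true⁺ {y} {x} (≰⇒> λ x≤y → <⇒≱ (<ᵇ-true⁻ (k ∸ x) (k ∸ y) b) (∸-monoʳ-≤ k x≤y)))
  (λ b → <ᵇ-true⁺ (∸-monoʳ-< (<ᵇ-true⁻ y x b) x≤k))

-- Heights are counted from 1; lineAt is t is the inverse of height is t.
height : List ℕ → ℕ → ℕ → ℕ
height is       zero    u = u
height []       (suc t) u = u
height (a ∷ is) (suc t) u = height is t (sw a u)

lineAt : List ℕ → ℕ → ℕ → ℕ
lineAt is       zero    p = p
lineAt []       (suc t) p = p
lineAt (a ∷ is) (suc t) p = sw a (lineAt is t p)

height-lineAt : ∀ is t p → height is t (lineAt is t p) ≡ p
height-lineAt is       zero    p = refl
height-lineAt []       (suc t) p = refl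
height-lineAt (a ∷ is) (suc t) p = trans (cong (height is t) (sw-involutive a _)) (height-lineAt is t p)

lineAt-height : ∀ is t u → lineAt is t (height is t u) ≡ u
lineAt-height is       zero    u = refl
lineAt-height []       (suc t) u = refl
lineAt-height (a ∷ is) (suc t) u = trans (cong (sw a) (lineAt-height is t (sw a u))) (sw-involutive a u)

height-injective : ∀ is t {u v} → height is t u ≡ height is t v → u ≡ v
height-injective is t {u} {v} e = trans (sym (lineAt-height is t u))
  (trans (cong (lineAt is t) e) (lineAt-height is t v))

lineAt-length : ∀ is p → lineAt is (length is) p ≡ evalWord is p
lineAt-length []       p = refl
lineAt-length (a ∷ is) p = cong (sw a) (lineAt-length is p)

height-step : ∀ is s u → height is (suc (toℕ s)) u ≡ sw (lookup is s) (height is (toℕ s) u)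
height-step (a ∷ is) Fin.zero    u = refl
height-step (a ∷ is) (Fin.suc s) u = height-step is s (sw a u)

lower upper : ∀ is → Fin (length is) → ℕ
lower is s = lineAt is (toℕ s) (lookup is s)
upper is s = lineAt is (toℕ s) (suc (lookup is s))

-- Split the word as u s v at the letter `t`. Then u v is the product of u s u⁻¹ and the word, and u
-- s u⁻¹ exchanges the two lines that cross at `t`.
delete-letter : ∀ {P : ℕ → Set} is (t : Fin (length is)) → All P is → ∃ λ js →
  suc (length js) ≡ length is × All P js ×
                (∀ x → evalWord js x ≡ transpose (lower is t) (upper is t) (evalWord is x))
delete-letter (a ∷ is) Fin.zero (_ ∷ ps) = is , refl , ps , λ x → sym (sw-involutive a (evalWord is x))
delete-letter (a ∷ is) (Fin.suc t) (p ∷ ps) with js , l , qs , e ← delete-letter is t ps =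
  a ∷ js , cong suc l , p ∷ qs , λ x → trans (cong (sw a) (e x)) (transpose-conj (sw-injective a) (lower is t) (upper is t) (evalWord is x))

-- The deletion condition: if two lines cross twice, both crossings may be deleted.
delete-double-crossing : ∀ {P : ℕ → Set} is (s t : Fin (length is)) → toℕ s < toℕ t →
  (lower is s ≡ lower is t × upper is s ≡ upper is t) ⊎ (lower is s ≡ upper is t × upper is s ≡ lower is t) →
  All P is → ∃ λ js → suc (suc (length js)) ≡ length is × All P js × (∀ x → evalWord js x ≡ evalWord is x)
delete-double-crossing (a ∷ is) Fin.zero (Fin.suc t) _ c (_ ∷ ps) with js , l , qs , e ← delete-letter is t ps =
  js , cong suc l , qs , λ x → trans (e x) (transposition c (evalWord is x))
  where
  unswap : ∀ {x y} → x ≡ sw a y → y ≡ sw a x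
  unswap e = trans (sym (sw-involutive a _)) (cong (sw a) (sym e))
  -- Seen from the tail, the two lines of `t` are `a` and `suc a` in some order, so deleting `t`
  -- there contributes `sw a` and makes up for the deleted head.
  transposition : (a ≡ sw a (lower is t) × suc a ≡ sw a (upper is t)) ⊎ (a ≡ sw a (upper is t) × suc a ≡ sw a (lower is t)) →
                  ∀ x → transpose (lower is t) (upper is t) x ≡ sw a x
  transposition (inj₁ (e₁ , e₂)) x = trans
    (cong₂ (λ p q → transpose p q x) (trans (unswap e₁) (transpose-left a (suc a))) (trans (unswap e₂) (transpose-right a (suc a))))
    (transpose-sym (suc a) a x)
  transposition (inj₂ (e₁ , e₂)) x =
    cong₂ (λ p q → transpose p q x) (trans (unswap e₂) (transpose-right a (suc a))) (trans (unswap e₁) (transpose-left a (suc a)))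
delete-double-crossing (a ∷ is) (Fin.suc s) (Fin.suc t) (s≤s l) c (p ∷ ps)
  with js , e , qs , f ← delete-double-crossing is s t l
         (Sum.map (λ (x , y) → sw-injective a x , sw-injective a y) (λ (x , y) → sw-injective a x , sw-injective a y) c) ps
  = a ∷ js , cong suc e , p ∷ qs , λ x → cong (sw a) (f x)

-- The wiring diagram of a reduced word

module WordArrangement (n : ℕ) (is : List ℕ) (reduced : IsReducedWordOf n (w0 n) is) where

  private
    letters = proj₁ (proj₁ reduced)
    evaluates = proj₂ (proj₁ reduced)
    minimal = proj₂ reduced

  IsLine : ℕ → Set
  IsLine u = 1 ≤ u × u ≤ suc n

  height-lower : ∀ s → height is (toℕ s) (lower is s) ≡ lookup is s
  height-lower s = height-lineAt is (toℕ s) _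

  height-upper : ∀ s → height is (toℕ s) (upper is s) ≡ suc (lookup is s)
  height-upper s = height-lineAt is (toℕ s) _

  height≡⇒lower : ∀ {s u} → height is (toℕ s) u ≡ lookup is s → u ≡ lower is s
  height≡⇒lower {s} e = height-injective is (toℕ s) (trans e (sym (height-lower s)))

  height≡⇒upper : ∀ {s u} → height is (toℕ s) u ≡ suc (lookup is s) → u ≡ upper is s
  height≡⇒upper {s} e = height-injective is (toℕ s) (trans e (sym (height-upper s)))

  height-lower-after : ∀ s → height is (suc (toℕ s)) (lower is s) ≡ suc (lookup is s)
  height-lower-after s = trans (height-step is s (lower is s))
    (trans (cong (sw (lookup is s)) (height-lower s)) (transpose-left (lookup is s) (suc (lookup is s))))

  height-upper-after : ∀ s → height is (suc (toℕ s)) (upper is s) ≡ lookup is s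
  height-upper-after s = trans (height-step is s (upper is s))
    (trans (cong (sw (lookup is s)) (height-upper s)) (transpose-right (lookup is s) (suc (lookup is s))))

  height-final : ∀ {u} → IsLine u → height is (length is) u ≡ suc (suc n) ∸ u
  height-final {u} (1≤u , u≤) = trans (cong (height is (length is)) (sym e)) (height-lineAt is (length is) p)
    where
    p = suc (suc n) ∸ u
    e : lineAt is (length is) p ≡ u
    e = trans (lineAt-length is p) (trans (evaluates p (m<n⇒0<n∸m (s≤s u≤)) (∸-monoʳ-≤ (suc (suc n)) 1≤u))
      (m∸[m∸n]≡n (m≤n⇒m≤1+n u≤)))

  no-double-crossing : ∀ {s t} → toℕ s < toℕ t →
    ¬ ((lower is s ≡ lower is t × upper is s ≡ upper is t) ⊎ (lower is s ≡ upper is t × upper is s ≡ lower is t))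
  no-double-crossing {s} {t} l c with js , e , ps , f ← delete-double-crossing is s t l c letters =
    <⇒≱ (≤-trans (n≤1+n _) (≤-reflexive e)) (minimal js (ps , λ x a b → trans (f x) (evaluates x a b)))

  arrangement : Arrangement (length is)
  arrangement = record
    { Line = IsLine
    ; below = λ t u v → height is t u <ᵇ height is t v
    ; lo = lower is ; hi = upper is
    ; below-flip = λ t ne → <ᵇ-flip (ne ∘ height-injective is t)
    ; below-irr = λ t u → <ᵇ-irrefl (height is t u)
    ; below-trans = λ t {u} {v} {w} a b → <ᵇ-true⁺ (<-trans (<ᵇ-true⁻ (height is t u) _ a) (<ᵇ-true⁻ (height is t v) (height is t w) b))
    ; below-lohi = λ s → <ᵇ-true⁺ (≤-reflexive (trans (cong suc (height-lower s)) (sym (height-upper s))))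
    ; below-adj = λ s {w} a b → trans (cong (height is (toℕ s) w <ᵇ_) (height-lower s))
        (trans (<ᵇ-suc (a ∘ height≡⇒lower)) (cong (height is (toℕ s) w <ᵇ_) (sym (height-upper s))))
    ; below-swap = λ s → <ᵇ-true⁺ (≤-reflexive (trans (cong suc (height-upper-after s)) (sym (height-lower-after s))))
    ; below-keep = λ s {u} {v} ne → trans (cong₂ _<ᵇ_ (height-step is s u) (height-step is s v))
        (sw-<ᵇ (lookup is s) (λ (a , b) → ne (inj₁ (height≡⇒lower a , height≡⇒upper b)))
                             (λ (a , b) → ne (inj₂ (height≡⇒upper a , height≡⇒lower b))))
    ; once = once
    ; final = λ {u} {v} lu lv _ → trans (cong₂ _<ᵇ_ (height-final lu) (height-final lv))
        (∸-<ᵇ (m≤n⇒m≤1+n (proj₂ lu)) (m≤n⇒m≤1+n (proj₂ lv)))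
    }
    where
    once : ∀ s t → (lower is s ≡ lower is t × upper is s ≡ upper is t) ⊎ (lower is s ≡ upper is t × upper is s ≡ lower is t) → s ≡ t
    once s t c with <-cmp (toℕ s) (toℕ t)
    ... | tri≈ _ e _ = toℕ-injective e
    ... | tri< l _ _ = contradiction c (no-double-crossing l)
    ... | tri> _ _ l = contradiction (Sum.map (λ (a , b) → sym a , sym b) (λ (a , b) → sym b , sym a) c) (no-double-crossing l)

-- Intervals of lines

range : ℕ → ℕ → List ℕ
range a zero    = []
range a (suc k) = a ∷ range (suc a) k

∈-range⁻ : ∀ {a k v} → v ∈ range a k → a ≤ v × v < a + k
∈-range⁻ {a} {suc k} (here refl) = ≤-refl , m<m+n a (s≤s z≤n)
∈-range⁻ {a} {suc k} {v} (there v∈) with l , l′ ← ∈-range⁻ v∈ = <⇒≤ l , subst (v <_) (sym (+-suc a k)) l′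

∈-range⁺ : ∀ {a k v} → a ≤ v → v < a + k → v ∈ range a k
∈-range⁺ {a} {zero} {v} l l′ = contradiction (subst (v <_) (+-identityʳ a) l′) (≤⇒≯ l)
∈-range⁺ {a} {suc k} {v} l l′ with m≤n⇒m<n∨m≡n l
... | inj₁ a<v  = there (∈-range⁺ a<v (subst (v <_) (+-suc a k) l′))
... | inj₂ refl = here refl

range-unique : ∀ a k → Unique (range a k)
range-unique a zero    = []
range-unique a (suc k) = All.tabulate (λ v∈ e → <-irrefl e (proj₁ (∈-range⁻ v∈))) ∷ range-unique (suc a) k

length-range : ∀ a k → length (range a k) ≡ k
length-range a zero    = refl
length-range a (suc k) = cong suc (length-range (suc a) k)

range-∷ʳ : ∀ a k → range a (suc k) ≡ range a k ∷ʳ (a + k)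
range-∷ʳ a zero    = cong (_∷ []) (sym (+-identityʳ a))
range-∷ʳ a (suc k) = cong (a ∷_) (trans (range-∷ʳ (suc a) k) (cong (range (suc a) k ∷ʳ_) (sym (+-suc a k))))

-- Contraction deletes the head of the list of lines, and for `D` this has to be the last line.
range-last : ∀ a k → range a (suc k) ↭ (a + k) ∷ range a k
range-last a k rewrite range-∷ʳ a k = ↭-sym (∷↭∷ʳ (a + k) (range a k))

count-range : ∀ a k {u} → a ≤ u → u ≤ a + k → a + count (λ v → v <ᵇ u) (range a k) ≡ u
count-range a zero    {u} l l′ = ≤-antisym (subst (_≤ u) (sym (+-identityʳ a)) l) l′
count-range a (suc k) {u} l l′ with m≤n⇒m<n∨m≡n l
... | inj₁ a<u = trans (cong (a +_) (count-∷-true (λ v → v <ᵇ u) (<ᵇ-true⁺ a<u)))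
  (trans (+-suc a _) (count-range (suc a) k a<u (subst (u ≤_) (+-suc a k) l′)))
... | inj₂ refl = trans (cong (a +_) (count-none (λ v → v <ᵇ a) {range a (suc k)} λ {v} v∈ → not-< (proj₁ (∈-range⁻ v∈))))
  (+-identityʳ a)
  where
  not-< : ∀ {v} → a ≤ v → (v <ᵇ a) ≡ false
  not-< {v} a≤v with v <ᵇ a in e
  ... | true  = contradiction (<ᵇ-true⁻ v a e) (≤⇒≯ a≤v)
  ... | false = refl

-- The heap order of a word

module Reachability (is : List ℕ) where

  private
    m = length is

  cover : Fin m → Fin m → Bool
  cover j k = (toℕ j <ᵇ toℕ k) ∧ ((suc (lookup is j) ≡ᵇ lookup is k) ∨ (suc (lookup is k) ≡ᵇ lookup is j))

  -- The function reach of Defs is private; its name is recovered by unification, after the fuel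
  -- (but not the index of Fin) has been abstracted to a variable.
  mutual
    reach : ℕ → Fin (length is) → Fin (length is) → Bool
    reach = _

    le≡reach : ∀ j k → le (wordPoset is) j k ≡ reach (length is) j k
    le≡reach j k with length is | eqF j k
    ... | w | _ = refl

  data Path : Fin m → Fin m → Set where
    nil  : ∀ {j} → Path j j
    cons : ∀ {j l k} → cover j l ≡ true → Path l k → Path j k

  cover⁻ : ∀ {j k} → cover j k ≡ true →
    toℕ j < toℕ k × (suc (lookup is j) ≡ lookup is k ⊎ suc (lookup is k) ≡ lookup is j)
  cover⁻ {j} {k} e with l , e′ ← ∧-true⁻ {toℕ j <ᵇ toℕ k} e with suc (lookup is j) ≡ᵇ lookup is k in eq
  ... | true  = <ᵇ-true⁻ (toℕ j) (toℕ k) l , inj₁ (≡ᵇ-true⁻ (suc (lookup is j)) (lookup is k) eq)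
  ... | false = <ᵇ-true⁻ (toℕ j) (toℕ k) l , inj₂ (≡ᵇ-true⁻ (suc (lookup is k)) (lookup is j) e′)

  cover⁺ : ∀ {j k} → toℕ j < toℕ k → suc (lookup is j) ≡ lookup is k ⊎ suc (lookup is k) ≡ lookup is j →
    cover j k ≡ true
  cover⁺ {j} {k} l c = ∧-true⁺ (<ᵇ-true⁺ l) (adjacent c)
    where
    adjacent : suc (lookup is j) ≡ lookup is k ⊎ suc (lookup is k) ≡ lookup is j →
               ((suc (lookup is j) ≡ᵇ lookup is k) ∨ (suc (lookup is k) ≡ᵇ lookup is j)) ≡ true
    adjacent (inj₁ e) rewrite ≡ᵇ-true⁺ {suc (lookup is j)} {lookup is k} e = refl
    adjacent (inj₂ e) rewrite ≡ᵇ-true⁺ {suc (lookup is k)} {lookup is j} e = Boolₚ.∨-zeroʳ _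

  Path-≤ : ∀ {j k} → Path j k → toℕ j ≤ toℕ k
  Path-≤ nil        = ≤-refl
  Path-≤ (cons c p) = ≤-trans (<⇒≤ (proj₁ (cover⁻ c))) (Path-≤ p)

  Path-++ : ∀ {j l k} → Path j l → Path l k → Path j k
  Path-++ nil q        = q
  Path-++ (cons c p) q = cons c (Path-++ p q)

  reach⇒Path : ∀ t {j k} → reach t j k ≡ true → Path j k
  reach⇒Path zero {j} {k} e = subst (Path j) (eqF-true⁻ e) nil
  reach⇒Path (suc t) {j} {k} e with eqF j k in eq
  ... | true  = subst (Path j) (eqF-true⁻ eq) nil
  ... | false with l , _ , e′ ← any-true⁻ (λ l → cover j l ∧ reach t l k) (allFin m) e with c , r ← ∧-true⁻ {cover j l} e′ =
    cons c (reach⇒Path t r)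

  -- Every cover step increases the position, so the distance from `j` to `k` is enough fuel.
  Path⇒reach : ∀ t {j k} → Path j k → toℕ k ≤ toℕ j + t → reach t j k ≡ true
  Path⇒reach zero    {j} nil _ = eqF-refl j
  Path⇒reach (suc t) {j} nil _ rewrite eqF-refl j = refl
  Path⇒reach zero    {j} {k} (cons c p) b = contradiction (subst (toℕ k ≤_) (+-identityʳ (toℕ j)) b)
    (<⇒≱ (≤-trans (proj₁ (cover⁻ c)) (Path-≤ p)))
  Path⇒reach (suc t) {j} {k} (cons {l = l} c p) b
    rewrite any-true⁺ (λ l → cover j l ∧ reach t l k) (∈-allFin l) (∧-true⁺ {cover j l} c (Path⇒reach t p
      (≤-trans b (subst (_≤ toℕ l + t) (sym (+-suc (toℕ j) t)) (+-monoˡ-≤ t (proj₁ (cover⁻ c))))))) = Boolₚ.∨-zeroʳ _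

  le⇒Path : ∀ {j k} → le (wordPoset is) j k ≡ true → Path j k
  le⇒Path {j} {k} e = reach⇒Path (length is) (trans (sym (le≡reach j k)) e)

  Path⇒le : ∀ {j k} → Path j k → le (wordPoset is) j k ≡ true
  Path⇒le {j} {k} p = trans (le≡reach j k) (Path⇒reach (length is) p (≤-trans (<⇒≤ (toℕ<n k)) (m≤n+m m (toℕ j))))

module WordOrder (n : ℕ) (is : List ℕ) (reduced : IsReducedWordOf n (w0 n) is) where
  open WordArrangement n is reduced
  open Arrangement arrangement using (Crosses)
  open ArrangementProperties arrangement
  open Reachability is

  private
    m = length is
    a = lookup is

  -- The condition for line `u` to take part in a letter `c` placed at time `j`.
  At : ℕ → ℕ → ℕ → Set
  At j u c = height is j u ≡ c ⊎ height is j u ≡ suc c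

  on⇒At : ∀ {u s} → On u s → At (toℕ s) u (a s)
  on⇒At {s = s} (inj₁ refl) = inj₁ (height-lower s)
  on⇒At {s = s} (inj₂ refl) = inj₂ (height-upper s)

  At⇒on : ∀ {u s} → At (toℕ s) u (a s) → On u s
  At⇒on (inj₁ e) = inj₁ (height≡⇒lower e)
  At⇒on (inj₂ e) = inj₂ (height≡⇒upper e)

  At-meet : ∀ {j u c d} → At j u c → At j u d → c ≡ d ⊎ (suc c ≡ d ⊎ suc d ≡ c)
  At-meet (inj₁ p) (inj₁ q) = inj₁ (trans (sym p) q)
  At-meet (inj₁ p) (inj₂ q) = inj₂ (inj₂ (trans (sym q) p))
  At-meet (inj₂ p) (inj₁ q) = inj₂ (inj₁ (trans (sym p) q))
  At-meet (inj₂ p) (inj₂ q) = inj₁ (suc-injective (trans (sym p) q))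

  height-off : ∀ {u s} → ¬ On u s → height is (suc (toℕ s)) u ≡ height is (toℕ s) u
  height-off {u} {s} ¬on = trans (height-step is s u)
    (transpose-other (λ e → ¬on (At⇒on (inj₁ e))) (λ e → ¬on (At⇒on (inj₂ e))))

  At-after : ∀ {u s} → On u s → At (suc (toℕ s)) u (a s)
  At-after {s = s} (inj₁ refl) = inj₂ (height-lower-after s)
  At-after {s = s} (inj₂ refl) = inj₁ (height-upper-after s)

  On? : ∀ u s → Dec (On u s)
  On? u s = (u ≟ lower is s) ⊎-dec (u ≟ upper is s)

  module _ (s : Fin m) {u : ℕ} (us : On u s) where

    -- z is the last crossing on u before time j, with w. Until some crossing y covering z has
    -- occurred, w remains next to u.
    record State (j : ℕ) : Set where
      field
        z       : Fin m
        z<j     : toℕ z < j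
        path    : Path s z
        w       : ℕ
        u≢w     : u ≢ w
        crosses : Crosses z u w
        u-at    : At j u (a z)
        covered : At j w (a z) ⊎ ∃ λ y → toℕ y < j × cover z y ≡ true

    arrive : ∀ r → State (toℕ r) → On u r → Path s r
    arrive r S ur with At-meet {toℕ r} {u} (State.u-at S) (on⇒At ur) | State.covered S
    ... | inj₂ adj | _ = Path-++ (State.path S) (cons (cover⁺ (State.z<j S) adj) nil)
    -- The letters of `z` and `r` are equal, so `y`, which covers `z` and comes before `r`, is
    -- adjacent to both.
    ... | inj₁ e | inj₂ (y , y<r , zy) = Path-++ (State.path S)
      (cons zy (cons (cover⁺ y<r (Sum.map (λ p → trans p e) (λ p → trans (cong suc (sym e)) p) (Sum.swap (proj₂ (cover⁻ zy))))) nil))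
    -- With `w` still next to `u`, the crossing `r` would be a second crossing of `u` and `w`.
    ... | inj₁ e | inj₁ wat = contradiction (State.z<j S) (<-irrefl (cong toℕ (once′ (State.crosses S)
      (on-both {r} (State.u≢w S) ur (At⇒on {s = r} (subst (At (toℕ r) (State.w S)) e wat))))))

    fresh : ∀ r → Path s r → On u r → State (suc (toℕ r))
    fresh r p ur with w , u≢w , c ← partner {s = r} ur = record
      { z = r ; z<j = ≤-refl ; path = p ; w = w ; u≢w = u≢w ; crosses = c
      ; u-at = At-after {s = r} ur ; covered = inj₁ (At-after {s = r} (Crosses⇒On {r} (Crosses-sym {r} c))) }

    State-step : ∀ r → State (toℕ r) → State (suc (toℕ r))
    State-step r S with On? u r
    ... | yes ur = fresh r (arrive r S ur) ur
    ... | no ¬ur = record { z = z ; z<j = m<n⇒m<1+n z<j ; path = path ; w = w ; u≢w = u≢w ; crosses = crosses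
                          ; u-at = subst (λ h → h ≡ a z ⊎ h ≡ suc (a z)) (sym (height-off ¬ur)) u-at
                          ; covered = still covered }
      where
      open State S
      still : At (toℕ r) w (a z) ⊎ (∃ λ y → toℕ y < toℕ r × cover z y ≡ true) →
              At (suc (toℕ r)) w (a z) ⊎ (∃ λ y → toℕ y < suc (toℕ r) × cover z y ≡ true)
      still (inj₂ (y , y<r , c)) = inj₂ (y , m<n⇒m<1+n y<r , c)
      still (inj₁ wat) with On? w r
      ... | no ¬wr = inj₁ (subst (λ h → h ≡ a z ⊎ h ≡ suc (a z)) (sym (height-off ¬wr)) wat)
      ... | yes wr with At-meet {toℕ r} {w} wat (on⇒At wr)
      ...   | inj₂ adj = inj₂ (r , ≤-refl , cover⁺ z<j adj)
      -- The same letter at `r` would also involve `u`, which has not moved since `z`.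
      ...   | inj₁ e   = contradiction (At⇒on (subst (At (toℕ r) u) e u-at)) ¬ur

    states : ∀ j → toℕ s < j → j ≤ m → State j
    states (suc j) (s≤s s≤j) j<m with m≤n⇒m<n∨m≡n s≤j
    ... | inj₂ refl = fresh s nil us
    ... | inj₁ s<j  = subst (λ k → State (suc k)) (toℕ-fromℕ< j<m)
      (State-step (fromℕ< j<m) (subst State (sym (toℕ-fromℕ< j<m)) (states j s<j (<⇒≤ j<m))))

  order : CrossingOrder arrangement (le (wordPoset is))
  order = record
    { R-refl = Path⇒le nil
    ; R-trans = λ p q → Path⇒le (Path-++ (le⇒Path p) (le⇒Path q))
    ; R-sound = λ p → Path-≤ (le⇒Path p)
    ; R-share = λ {s} {t} us ut l → Path⇒le (arrive s us t (states s us (toℕ t) l (<⇒≤ (toℕ<n t))) ut)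
    }

  private
    letters = proj₁ (proj₁ reduced)

  letter-bounds : ∀ s → 1 ≤ a s × a s ≤ n
  letter-bounds s = All.lookup letters (∈-lookup s)

  sw-line : ∀ {b u} → 1 ≤ b × b ≤ n → IsLine u → IsLine (sw b u)
  sw-line {b} {u} (1≤b , b≤n) (1≤u , u≤N) with transpose-spec b (suc b) u
  ... | inj₁ (_ , e)            rewrite e = s≤s z≤n , s≤s b≤n
  ... | inj₂ (inj₁ (_ , _ , e)) rewrite e = 1≤b , m≤n⇒m≤1+n b≤n
  ... | inj₂ (inj₂ (_ , _ , e)) rewrite e = 1≤u , u≤N

  lineAt-line : ∀ {js} → All (λ b → 1 ≤ b × b ≤ n) js → ∀ t {p} → IsLine p → IsLine (lineAt js t p)
  lineAt-line ps       zero    l = l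
  lineAt-line []       (suc t) l = l
  lineAt-line (b ∷ ps) (suc t) l = sw-line b (lineAt-line ps t l)

  lower-line : ∀ s → IsLine (lower is s)
  lower-line s = lineAt-line letters (toℕ s) (proj₁ (letter-bounds s) , m≤n⇒m≤1+n (proj₂ (letter-bounds s)))

  upper-line : ∀ s → IsLine (upper is s)
  upper-line s = lineAt-line letters (toℕ s) (s≤s z≤n , s≤s (proj₂ (letter-bounds s)))

  lines : List ℕ
  lines = range 1 (suc n)

  line⇒∈ : ∀ {u} → IsLine u → u ∈ lines
  line⇒∈ (l , l′) = ∈-range⁺ l (s≤s l′)

  open Levels arrangement lines (range-unique 1 (suc n))

  -- At time 0 both sides are `u`, and each crossing changes both in the same way.
  level≡height : ∀ j → j ≤ m → ∀ {u} → IsLine u → suc (level j u) ≡ height is j u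
  level≡height zero    _   (l , l′) = count-range 1 (suc n) l (m≤n⇒m≤1+n l′)
  level≡height (suc j) j<m {u} lu = subst (λ k → suc (level (suc k) u) ≡ height is (suc k) u) (toℕ-fromℕ< j<m)
    (step (fromℕ< j<m) λ {v} → subst (λ k → IsLine v → suc (level k v) ≡ height is k v) (sym (toℕ-fromℕ< j<m)) (level≡height j (<⇒≤ j<m)))
    where
    step : ∀ s → (∀ {v} → IsLine v → suc (level (toℕ s) v) ≡ height is (toℕ s) v) →
           suc (level (suc (toℕ s)) u) ≡ height is (suc (toℕ s)) u
    step s ih with On? u s
    ... | no ¬on = trans (cong suc (level-not-on ¬on)) (trans (ih lu) (sym (height-off ¬on)))
    ... | yes (inj₁ refl) = trans (cong suc (level-lo-after (line⇒∈ (lower-line s) , line⇒∈ (upper-line s))))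
      (trans (cong suc (trans (ih lu) (height-lower s))) (sym (height-lower-after s)))
    ... | yes (inj₂ refl) = trans (cong suc level-hi-after)
      (trans (trans (ih (lower-line s)) (height-lower s)) (sym (height-upper-after s)))

  -- Makes the columns recoverable from the triple data, which tell how many lines run below a
  -- crossing.
  letter≡level : ∀ s → a s ≡ suc (level (toℕ s) (lower is s))
  letter≡level s = trans (sym (height-lower s)) (sym (level≡height (toℕ s) (<⇒≤ (toℕ<n s)) (lower-line s)))

  model : ∀ {P} → P ∼ wordPoset is → Model arrangement (le (wordPoset is)) lines P
  model P∼ = record
    { embedded = record
      { emb = to ; emb-inj = λ {x} {y} e → trans (sym (strictlyInverseʳ x)) (trans (cong from e) (strictlyInverseʳ y))
      ; inside = λ x → line⇒∈ (lower-line (to x)) , line⇒∈ (upper-line (to x))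
      ; onto = λ {s} _ _ → from s , strictlyInverseˡ s
      ; le≡R = _∼_.le-pres P∼ }
    ; col≡ = λ x → trans (sym (_∼_.col-pres P∼ x)) (letter≡level (to x)) }
    where open Inverse (_∼_.iso P∼)

-- Triples of lines

Standard : ∀ {m} → Arrangement m → Set
Standard arr = ∀ u v → Arrangement.below arr 0 u v ≡ (u <ᵇ v)

module StandardProperties {m} (arr : Arrangement m) (standard : Standard arr) where
  open Arrangement arr
  open ArrangementProperties arr

  lo<hi : ∀ s → lo s < hi s
  lo<hi s = <ᵇ-true⁻ (lo s) (hi s) (trans (sym (standard (lo s) (hi s)))
    (trans (below-before (inj₁ (refl , refl)) z≤n) (below-lohi s)))

  ordered-crossing : ∀ {s u v} → u < v → Crosses s u v → lo s ≡ u × hi s ≡ v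
  ordered-crossing l (inj₁ (e , e′)) = sym e , sym e′
  ordered-crossing {s} l (inj₂ (refl , refl)) = contradiction (lo<hi s) (<-asym l)

  lines-cross-< : ∀ {u v} → Line u → Line v → u < v → ∃ λ s → lo s ≡ u × hi s ≡ v
  lines-cross-< lu lv l with s , c ← lines-cross lu lv (<⇒≢ l) = s , ordered-crossing l c

  -- The order is that of the labels before the crossing and the reverse after it. This turns bits
  -- of the triple data into comparisons of times.
  crossed-before : ∀ {t u v} → u < v → Crosses t u v → ∀ (s : Fin m) → below (toℕ s) v u ≡ (toℕ t <ᵇ toℕ s)
  crossed-before {t} {u} {v} l c s with <-≤-connex (toℕ t) (toℕ s)
  ... | inj₁ t<s = trans (below-after-0 (Crosses-sym c) t<s (<⇒≤ (toℕ<n s)))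
    (trans (sym (below-flip 0 (<⇒≢ l))) (trans (standard u v) (trans (<ᵇ-true⁺ l) (sym (<ᵇ-true⁺ t<s)))))
  ... | inj₂ s≤t = trans (below-before (Crosses-sym c) s≤t) (trans (sym (below-before (Crosses-sym c) z≤n))
    (trans (standard v u) (trans (≥⇒<ᵇ-false (<⇒≤ l)) (sym (≥⇒<ᵇ-false s≤t)))))
    where
    ≥⇒<ᵇ-false : ∀ {x y} → y ≤ x → (x <ᵇ y) ≡ false
    ≥⇒<ᵇ-false {x} {y} y≤x with x <ᵇ y in e
    ... | true  = contradiction (<ᵇ-true⁻ x y e) (≤⇒≯ y≤x)
    ... | false = refl

  -- For lines a < x < b, the crossings ab, xb and ax determine each other's position: the two
  -- possible orders are ax, ab, xb and xb, ab, ax.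
  module Triple {a x b : ℕ} (a<x : a < x) (x<b : x < b)
                {p q r : Fin m} (ax : Crosses p a x) (ab : Crosses q a b) (xb : Crosses r x b) where

    private
      a<b = <-trans a<x x<b

    not-third : ∀ {s u v w} → Crosses s u v → w ≢ u → w ≢ v → ¬ On w s
    not-third (inj₁ (refl , refl)) w≢u w≢v (inj₁ e) = w≢u e
    not-third (inj₁ (refl , refl)) w≢u w≢v (inj₂ e) = w≢v e
    not-third (inj₂ (refl , refl)) w≢u w≢v (inj₁ e) = w≢v e
    not-third (inj₂ (refl , refl)) w≢u w≢v (inj₂ e) = w≢u e

    time≢ : ∀ {s t w} → ¬ On w s → On w t → toℕ s ≢ toℕ t
    time≢ ¬on on e with refl ← toℕ-injective e = ¬on on

    below-third : ∀ {s u v w} → Crosses s u v → w ≢ u → w ≢ v → below (toℕ s) w u ≡ below (toℕ s) w v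
    below-third {s} (inj₁ (refl , refl)) ne ne′ = below-adj s ne ne′
    below-third {s} (inj₂ (refl , refl)) ne ne′ = sym (below-adj s ne′ ne)

    at-ab : below (toℕ q) x a ≡ not (below (toℕ p) b a)
    at-ab = trans (crossed-before a<x ax q)
      (trans (<ᵇ-flip (time≢ (not-third ax (<⇒≢ a<b ∘ sym) (<⇒≢ x<b ∘ sym)) (Crosses⇒On (Crosses-sym ab))))
        (cong not (sym (crossed-before a<b ab p))))

    at-xb : below (toℕ r) a x ≡ below (toℕ p) b a
    at-xb = begin
      below (toℕ r) a x         ≡⟨ below-flip _ (<⇒≢ a<x) ⟩
      not (below (toℕ r) x a)   ≡⟨ cong not (crossed-before a<x ax r) ⟩
      not (toℕ p <ᵇ toℕ r)      ≡⟨ sym (<ᵇ-flip (time≢ (not-third xb (<⇒≢ a<x) (<⇒≢ a<b)) (Crosses⇒On ax))) ⟩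
      (toℕ r <ᵇ toℕ p)          ≡⟨ sym (crossed-before x<b xb p) ⟩
      below (toℕ p) b x         ≡⟨ sym (below-third ax (<⇒≢ a<b ∘ sym) (<⇒≢ x<b ∘ sym)) ⟩
      below (toℕ p) b a         ∎
      where open ≡-Reasoning

-- Comparing two diagrams

record RightPairs {m} (arr : Arrangement m) (L : ℕ) (ls : List ℕ) (ps : List (ℕ × ℕ)) : Set where
  open Arrangement arr
  field
    unique   : Unique ps
    sound    : ∀ {u v} → (u , v) ∈ ps →
               ∃ λ s → lo s ≡ u × hi s ≡ v × u ∈ ls × v ∈ ls × below (toℕ s) L u ≡ true
    complete : ∀ {s} → lo s ∈ ls → hi s ∈ ls → below (toℕ s) L (lo s) ≡ true → (lo s , hi s) ∈ ps

-- Crossings of the two diagrams correspond by their lines, as their times are unrelated. Comparing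
-- with `lo` suffices, since a line off the crossing has the same position relative to `hi`.
Agree : ∀ {m₁ m₂} → Arrangement m₁ → Arrangement m₂ → List ℕ → Set
Agree arr₁ arr₂ ls = ∀ s t → A₁.lo s ≡ A₂.lo t → A₁.hi s ≡ A₂.hi t → A₁.lo s ∈ ls → A₁.hi s ∈ ls →
                     ∀ {w} → w ∈ ls → A₁.below (toℕ s) w (A₁.lo s) ≡ A₂.below (toℕ t) w (A₂.lo t)
  where
  module A₁ = Arrangement arr₁
  module A₂ = Arrangement arr₂

Agree-sym : ∀ {m₁ m₂} (arr₁ : Arrangement m₁) (arr₂ : Arrangement m₂) {ls} → Agree arr₁ arr₂ ls →
  Agree arr₂ arr₁ ls
Agree-sym arr₁ arr₂ {ls} agr s t e e′ l h w∈ =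
  sym (agr t s (sym e) (sym e′) (subst (_∈ ls) e l) (subst (_∈ ls) e′ h) w∈)

-- The lines x whose crossing with a comes after b form a final segment of the order along a; so
-- if the two arrangements disagree at x, one of the two lists of pairs strictly contains the other.
no-disagreement : ∀ {m₁ m₂} (arr₁ : Arrangement m₁) (arr₂ : Arrangement m₂) → Standard arr₁ → Standard arr₂ →
  ∀ a k →
  (∀ {u} → u ∈ range a (suc (suc k)) → Arrangement.Line arr₁ u) →
  (∀ {u} → u ∈ range a (suc (suc k)) → Arrangement.Line arr₂ u) →
  Agree arr₁ arr₂ (range a (suc k)) → Agree arr₁ arr₂ (range (suc a) (suc k)) →
  ∀ {ps₁ ps₂} → RightPairs arr₁ (a + suc k) (range a (suc k)) ps₁ → RightPairs arr₂ (a + suc k) (range a (suc k)) ps₂ →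
  length ps₁ ≡ length ps₂ →
  ∀ {x s t} → x ∈ range (suc a) k → Arrangement.Crosses arr₁ s a x → Arrangement.Crosses arr₂ t a x →
  Arrangement.below arr₁ (toℕ s) (a + suc k) a ≡ true → Arrangement.below arr₂ (toℕ t) (a + suc k) a ≢ false
no-disagreement {m₁} {m₂} arr₁ arr₂ st₁ st₂ a k lines₁ lines₂ agrD agrA {ps₁} {ps₂} rp₁ rp₂ len {x} {s} {t} x∈ c₁ c₂ b₁ b₂ =
  let s′ , e , e′ , _ , _ , b₂′ = R₂.sound (⊇ ax∈)
      t≡ = P₂.once′ c₂ (inj₁ (sym e , sym e′))
  in Boolₚ.not-¬ (trans (sym b₂) (cong (λ t → A₂.below (toℕ t) b a) t≡)) (cong not (sym b₂′))
  where
  module A₁ = Arrangement arr₁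
  module A₂ = Arrangement arr₂
  module P₁ = ArrangementProperties arr₁
  module P₂ = ArrangementProperties arr₂
  module S₁ = StandardProperties arr₁ st₁
  module S₂ = StandardProperties arr₂ st₂
  module R₁ = RightPairs rp₁
  module R₂ = RightPairs rp₂
  b = a + suc k

  a<x : a < x
  a<x = proj₁ (∈-range⁻ x∈)

  x<b : x < b
  x<b = subst (x <_) (sym (+-suc a k)) (proj₂ (∈-range⁻ x∈))

  a<b : a < b
  a<b = <-trans a<x x<b

  ∈-widen : ∀ {v} → v ∈ range a (suc k) → v ∈ range a (suc (suc k))
  ∈-widen v∈ with l , l′ ← ∈-range⁻ v∈ = ∈-range⁺ l (<-≤-trans l′ (+-monoʳ-≤ a (n≤1+n (suc k))))

  b∈ : b ∈ range a (suc (suc k))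
  b∈ = ∈-range⁺ (<⇒≤ a<b) (+-monoʳ-< a ≤-refl)

  b∈A : b ∈ range (suc a) (suc k)
  b∈A = ∈-range⁺ a<b ≤-refl

  ax∈ : (a , x) ∈ ps₁
  ax∈ with e , e′ ← S₁.ordered-crossing a<x c₁ = subst (_∈ ps₁) (cong₂ _,_ e e′)
    (R₁.complete (subst (_∈ range a (suc k)) (sym e) (here refl)) (subst (_∈ range a (suc k)) (sym e′) (there x∈))
      (trans (cong (A₁.below (toℕ s) b) e) b₁))

  ⊆ : ∀ {uv} → uv ∈ ps₂ → uv ∈ ps₁
  ⊆ {u , v} uv∈ with t′ , e , e′ , u∈ , v∈ , bt ← R₂.sound uv∈
    with u<v ← subst₂ _<_ e e′ (S₂.lo<hi t′)
    with s′ , refl , refl ← S₁.lines-cross-< (lines₁ (∈-widen u∈)) (lines₁ (∈-widen v∈)) u<v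
    = R₁.complete u∈ v∈ (below₁ u∈ v∈)
    where
    below₁ : A₁.lo s′ ∈ range a (suc k) → A₁.hi s′ ∈ range a (suc k) → A₁.below (toℕ s′) b (A₁.lo s′) ≡ true
    -- A pair without `a` lies in the interval that starts at `suc a`, where the position of `b` is
    -- known to agree.
    below₁ (there u∈) v∈ = trans (agrA s′ t′ (sym e) (sym e′) (widen u∈) (∈-range⁺ (≤-<-trans (proj₁ (∈-range⁻ {a} (there u∈))) (S₁.lo<hi s′))
        (<-trans (proj₂ (∈-range⁻ v∈)) ≤-refl)) b∈A)
      (trans (cong (A₂.below (toℕ t′) b) e) bt)
      where
      widen : ∀ {u} → u ∈ range (suc a) k → u ∈ range (suc a) (suc k)
      widen u∈ with l , l′ ← ∈-range⁻ u∈ = ∈-range⁺ l (<-≤-trans l′ (+-monoʳ-≤ (suc a) (n≤1+n k)))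
    -- A pair of `a` and some `y`. If it were missing from `ps₁`, then `a` would meet `y`, `b`, `x`
    -- in this order in the first diagram, but `x`, `b`, `y` in the second. At the crossing of `a`
    -- and `x` this contradicts `agrD`.
    below₁ (here u≡a) v∈ with A₁.below (toℕ s′) b (A₁.lo s′) in b₁′
    ... | true  = refl
    ... | false = contradiction (trans (sym below-sy) (trans (agrD-ax) below-ty)) λ ()
      where
      y = A₁.hi s′
      a<y : a < y
      a<y = subst (_< y) u≡a (S₁.lo<hi s′)
      ay₁ : A₁.Crosses s′ a y
      ay₁ = inj₁ (sym u≡a , refl)
      ay₂ : A₂.Crosses t′ a y
      ay₂ = inj₁ (trans (sym u≡a) (sym e) , sym e′)
      q₁ = P₁.lines-cross (lines₁ (here refl)) (lines₁ b∈) (<⇒≢ a<b)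
      q₂ = P₂.lines-cross (lines₂ (here refl)) (lines₂ b∈) (<⇒≢ a<b)
      ≤⁻ : ∀ {i j} → (i <ᵇ j) ≡ false → j ≤ i
      ≤⁻ f = ≮⇒≥ λ l → Boolₚ.not-¬ f (<ᵇ-true⁺ l)
      sy<sx : toℕ s′ < toℕ s
      sy<sx = ≤-<-trans
        (≤⁻ (trans (sym (S₁.crossed-before a<b (proj₂ q₁) s′)) (trans (cong (A₁.below (toℕ s′) b) (sym u≡a)) b₁′)))
        (<ᵇ-true⁻ (toℕ (proj₁ q₁)) (toℕ s) (trans (sym (S₁.crossed-before a<b (proj₂ q₁) s)) b₁))
      tx<ty : toℕ t < toℕ t′
      tx<ty = ≤-<-trans
        (≤⁻ (trans (sym (S₂.crossed-before a<b (proj₂ q₂) t)) b₂))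
        (<ᵇ-true⁻ (toℕ (proj₁ q₂)) (toℕ t′) (trans (sym (S₂.crossed-before a<b (proj₂ q₂) t′))
          (trans (cong (A₂.below (toℕ t′) b) (sym u≡a)) bt)))
      below-sy : A₁.below (toℕ s) y a ≡ true
      below-sy = trans (S₁.crossed-before a<y ay₁ s) (<ᵇ-true⁺ sy<sx)
      below-ty : A₂.below (toℕ t) y a ≡ false
      below-ty with A₂.below (toℕ t) y a in f
      ... | false = refl
      ... | true  = contradiction (<ᵇ-true⁻ (toℕ t′) (toℕ t) (trans (sym (S₂.crossed-before a<y ay₂ t)) f)) (<-asym tx<ty)
      agrD-ax : A₁.below (toℕ s) y a ≡ A₂.below (toℕ t) y a
      agrD-ax with e₁ , e₁′ ← S₁.ordered-crossing a<x c₁ | e₂ , e₂′ ← S₂.ordered-crossing a<x c₂ =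
        trans (cong (A₁.below (toℕ s) y) (sym e₁))
          (trans (agrD s t (trans e₁ (sym e₂)) (trans e₁′ (sym e₂′)) (subst (_∈ range a (suc k)) (sym e₁) (here refl))
                   (subst (_∈ range a (suc k)) (sym e₁′) (there x∈)) v∈)
            (cong (A₂.below (toℕ t) y) e₂))

  -- Equal lengths turn the inclusion into an equality, so `(a , x)` lies in `ps₂` too, against the
  -- assumption at `t`.
  ⊇ : ∀ {uv} → uv ∈ ps₁ → uv ∈ ps₂
  ⊇ = unique-⊆-length⇒⊇ (≡-dec _≟_ _≟_) R₂.unique ⊆ (≤-reflexive len)

agree-on-crossing-lines : ∀ {m₁ m₂} (arr₁ : Arrangement m₁) (arr₂ : Arrangement m₂) → ∀ {s t} →
  Arrangement.lo arr₁ s ≡ Arrangement.lo arr₂ t → Arrangement.hi arr₁ s ≡ Arrangement.hi arr₂ t →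
  ∀ {w} → ArrangementProperties.On arr₁ w s →
  Arrangement.below arr₁ (toℕ s) w (Arrangement.lo arr₁ s) ≡ Arrangement.below arr₂ (toℕ t) w (Arrangement.lo arr₂ t)
agree-on-crossing-lines arr₁ arr₂ {s} {t} e e′ (inj₁ refl) =
  trans (A₁.below-irr _ _) (sym (trans (cong (λ w → A₂.below (toℕ t) w (A₂.lo t)) e) (A₂.below-irr _ _)))
  where
  module A₁ = Arrangement arr₁
  module A₂ = Arrangement arr₂
agree-on-crossing-lines arr₁ arr₂ {s} {t} e e′ (inj₂ refl) =
  trans (ArrangementProperties.below-hilo arr₁ s)
    (sym (trans (cong (λ w → A₂.below (toℕ t) w (A₂.lo t)) e′) (ArrangementProperties.below-hilo arr₂ t)))
  where
  module A₂ = Arrangement arr₂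

module AgreeStep {m₁ m₂} (arr₁ : Arrangement m₁) (arr₂ : Arrangement m₂) (st₁ : Standard arr₁) (st₂ : Standard arr₂)
  (a k : ℕ)
  (lines₁ : ∀ {u} → u ∈ range a (suc (suc k)) → Arrangement.Line arr₁ u)
  (lines₂ : ∀ {u} → u ∈ range a (suc (suc k)) → Arrangement.Line arr₂ u)
  (agrD : Agree arr₁ arr₂ (range a (suc k))) (agrA : Agree arr₁ arr₂ (range (suc a) (suc k)))
  {ps₁ ps₂} (rp₁ : RightPairs arr₁ (a + suc k) (range a (suc k)) ps₁) (rp₂ : RightPairs arr₂ (a + suc k) (range a (suc k)) ps₂)
  (len : length ps₁ ≡ length ps₂) where

  private
    module A₁ = Arrangement arr₁
    module A₂ = Arrangement arr₂
    module P₁ = ArrangementProperties arr₁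
    module P₂ = ArrangementProperties arr₂
    module S₁ = StandardProperties arr₁ st₁
    module S₂ = StandardProperties arr₂ st₂
    b = a + suc k
    full = range a (suc (suc k))

  agree-extremes : ∀ {x s t} → x ∈ range (suc a) k → A₁.Crosses s a x → A₂.Crosses t a x →
                   A₁.below (toℕ s) b a ≡ A₂.below (toℕ t) b a
  agree-extremes {x} {s} {t} x∈ c₁ c₂ with A₁.below (toℕ s) b a in e₁ | A₂.below (toℕ t) b a in e₂
  ... | true  | true  = refl
  ... | false | false = refl
  ... | true  | false = contradiction e₂ (no-disagreement arr₁ arr₂ st₁ st₂ a k lines₁ lines₂ agrD agrA rp₁ rp₂ len x∈ c₁ c₂ e₁)
  ... | false | true  = contradiction e₁ (no-disagreement arr₂ arr₁ st₂ st₁ a k lines₂ lines₁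
    (Agree-sym arr₁ arr₂ agrD) (Agree-sym arr₁ arr₂ agrA) rp₂ rp₁ (sym len) x∈ c₂ c₁ e₂)

  lower-or-last : ∀ {v} → v ∈ full → v ∈ range a (suc k) ⊎ v ≡ b
  lower-or-last {v} v∈ with l , l′ ← ∈-range⁻ v∈ with m≤n⇒m<n∨m≡n (≤-pred (subst (v <_) (+-suc a (suc k)) l′))
  ... | inj₁ l″ = inj₁ (∈-range⁺ l l″)
  ... | inj₂ e  = inj₂ e

  mid : ∀ {v} → v ∈ full → v ≢ a → v ≢ b → v ∈ range (suc a) k
  mid v∈ v≢a v≢b with lower-or-last v∈
  ... | inj₂ e          = contradiction e v≢b
  ... | inj₁ (here e)   = contradiction e v≢a
  ... | inj₁ (there i)  = i

  not-first : ∀ {v} → v ∈ full → v ≢ a → v ∈ range (suc a) (suc k)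
  not-first (here e)   v≢a = contradiction e v≢a
  not-first (there v∈) _   = v∈

  not-last : ∀ {v} → v ∈ full → v ≢ b → v ∈ range a (suc k)
  not-last v∈ v≢b with lower-or-last v∈
  ... | inj₁ i = i
  ... | inj₂ e = contradiction e v≢b

  a<b : a < b
  a<b = m<m+n a (s≤s z≤n)

  module _ {x} (x∈ : x ∈ full) (x≢a : x ≢ a) (x≢b : x ≢ b) where

    private
      x∈mid = mid x∈ x≢a x≢b

      a<x : a < x
      a<x = proj₁ (∈-range⁻ x∈mid)

      x<b : x < b
      x<b = subst (x <_) (sym (+-suc a k)) (proj₂ (∈-range⁻ x∈mid))

      b∈ : b ∈ full
      b∈ = ∈-range⁺ (<⇒≤ a<b) (+-monoʳ-< a ≤-refl)

      ax₁ = P₁.lines-cross (lines₁ (here refl)) (lines₁ x∈) (<⇒≢ a<x)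
      ab₁ = P₁.lines-cross (lines₁ (here refl)) (lines₁ b∈) (<⇒≢ a<b)
      xb₁ = P₁.lines-cross (lines₁ x∈) (lines₁ b∈) (<⇒≢ x<b)
      ax₂ = P₂.lines-cross (lines₂ (here refl)) (lines₂ x∈) (<⇒≢ a<x)
      ab₂ = P₂.lines-cross (lines₂ (here refl)) (lines₂ b∈) (<⇒≢ a<b)
      xb₂ = P₂.lines-cross (lines₂ x∈) (lines₂ b∈) (<⇒≢ x<b)

      module T₁ = S₁.Triple a<x x<b (proj₂ ax₁) (proj₂ ab₁) (proj₂ xb₁)
      module T₂ = S₂.Triple a<x x<b (proj₂ ax₂) (proj₂ ab₂) (proj₂ xb₂)

      -- The one bit of this triple that is taken from the index; the bits at the other two
      -- crossings follow by `Triple`.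
      base : A₁.below (toℕ (proj₁ ax₁)) b a ≡ A₂.below (toℕ (proj₁ ax₂)) b a
      base = agree-extremes x∈mid (proj₂ ax₁) (proj₂ ax₂)

      at : ∀ {u v w s s′ t t′} → A₁.Crosses s u v → A₂.Crosses t u v → A₁.Crosses s′ u v → A₂.Crosses t′ u v →
           A₁.below (toℕ s′) w u ≡ A₂.below (toℕ t′) w u → A₁.below (toℕ s) w u ≡ A₂.below (toℕ t) w u
      at c₁ c₂ c₁′ c₂′ e rewrite P₁.once′ c₁ c₁′ | P₂.once′ c₂ c₂′ = e

    at-ax : ∀ {s t} → A₁.Crosses s a x → A₂.Crosses t a x → A₁.below (toℕ s) b a ≡ A₂.below (toℕ t) b a
    at-ax c₁ c₂ = at c₁ c₂ (proj₂ ax₁) (proj₂ ax₂) base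

    at-ab : ∀ {s t} → A₁.Crosses s a b → A₂.Crosses t a b → A₁.below (toℕ s) x a ≡ A₂.below (toℕ t) x a
    at-ab c₁ c₂ = at c₁ c₂ (proj₂ ab₁) (proj₂ ab₂) (trans T₁.at-ab (trans (cong not base) (sym T₂.at-ab)))

    at-xb : ∀ {s t} → A₁.Crosses s x b → A₂.Crosses t x b → A₁.below (toℕ s) a x ≡ A₂.below (toℕ t) a x
    at-xb c₁ c₂ = at c₁ c₂ (proj₂ xb₁) (proj₂ xb₂) (trans T₁.at-xb (trans base (sym T₂.at-xb)))

  -- A triple without `b` is settled by `agrD` and one without `a` by `agrA`. A triple of `a`, `x`
  -- and `b` occurs three times, according to which of its lines is `w`.
  agree-step : Agree arr₁ arr₂ full
  agree-step s t e e′ l∈ h∈ {w} w∈ = subst (λ z → A₁.below (toℕ s) w (A₁.lo s) ≡ A₂.below (toℕ t) w z) e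
    (go (A₁.lo s) (A₁.hi s) (inj₁ (refl , refl)) (inj₁ (e , e′)) refl refl l∈ h∈)
    where
    go : ∀ u v → A₁.Crosses s u v → A₂.Crosses t u v → u ≡ A₁.lo s → v ≡ A₁.hi s → u ∈ full → v ∈ full →
         A₁.below (toℕ s) w u ≡ A₂.below (toℕ t) w u
    go u v c₁ c₂ refl refl u∈ v∈ with w ≟ u | w ≟ v
    ... | yes p | _ = trans (agree-on-crossing-lines arr₁ arr₂ e e′ (inj₁ p)) (cong (A₂.below (toℕ t) w) (sym e))
    ... | _ | yes p = trans (agree-on-crossing-lines arr₁ arr₂ e e′ (inj₂ p)) (cong (A₂.below (toℕ t) w) (sym e))
    ... | no w≢u | no w≢v with u ≟ a | v ≟ b | w ≟ a | w ≟ b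
    ...   | yes refl | yes q | _ | _ = at-ab w∈ w≢u (w≢v ∘ flip-trans q) (subst (A₁.Crosses s u) q c₁) (subst (A₂.Crosses t u) q c₂)
      where
      flip-trans : ∀ {x y z : ℕ} → x ≡ y → z ≡ y → z ≡ x
      flip-trans p q = trans q (sym p)
    ...   | yes refl | no v≢b | _ | yes refl = at-ax v∈ (<⇒≢ (S₁.lo<hi s) ∘ sym) v≢b c₁ c₂
    ...   | yes refl | no v≢b | _ | no w≢b = trans
      (agrD s t e e′ (here refl) (not-last v∈ v≢b) (not-last w∈ w≢b)) (cong (A₂.below (toℕ t) w) (sym e))
    ...   | no u≢a | yes q | yes refl | _ = at-xb u∈ u≢a (λ p → <⇒≢ (S₁.lo<hi s) (trans p (sym q)))
      (subst (A₁.Crosses s u) q c₁) (subst (A₂.Crosses t u) q c₂)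
    ...   | no u≢a | no v≢b | yes refl | _ = trans
      (agrD s t e e′ (not-last u∈ λ p → <⇒≱ (S₁.lo<hi s) (subst (A₁.hi s ≤_) (sym p) (bound v∈))) (not-last v∈ v≢b) (here refl))
      (cong (A₂.below (toℕ t) w) (sym e))
      where
      bound : ∀ {v} → v ∈ full → v ≤ b
      bound {v} v∈ = ≤-pred (subst (v <_) (+-suc a (suc k)) (proj₂ (∈-range⁻ v∈)))
    ...   | no u≢a | _ | no w≢a | _ = trans
      (agrA s t e e′ (not-first u∈ u≢a) (not-first v∈ λ p → <⇒≱ (S₁.lo<hi s) (subst (_≤ A₁.lo s) (sym p) (proj₁ (∈-range⁻ u∈)))) (not-first w∈ w≢a))
      (cong (A₂.below (toℕ t) w) (sym e))

-- Induction over contractions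

module AgreeInduction {m₁ m₂} (arr₁ : Arrangement m₁) (arr₂ : Arrangement m₂) (st₁ : Standard arr₁) (st₂ : Standard arr₂)
  {R₁ R₂} (order₁ : CrossingOrder arr₁ R₁) (order₂ : CrossingOrder arr₂ R₂) where

  agree-pair : ∀ a → Agree arr₁ arr₂ (range a 2)
  agree-pair a s t e e′ l∈ h∈ w∈ =
    agree-on-crossing-lines arr₁ arr₂ e e′ (one-of (ArrangementProperties.lo≢hi arr₁ s) l∈ h∈ w∈)
    where
    one-of : ∀ {u v w} → u ≢ v → u ∈ range a 2 → v ∈ range a 2 → w ∈ range a 2 → w ≡ u ⊎ w ≡ v
    one-of u≢v (here refl)         (here refl)         _           = contradiction refl u≢v
    one-of u≢v (there (here refl)) (there (here refl)) _           = contradiction refl u≢v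
    one-of u≢v (here refl)         _                   (here refl) = inj₁ refl
    one-of u≢v (there (here refl)) _                   (there (here refl)) = inj₁ refl
    one-of u≢v _                   (here refl)         (here refl) = inj₂ refl
    one-of u≢v _                   (there (here refl)) (there (here refl)) = inj₂ refl

  module Contractions {m} (arr : Arrangement m) (st : Standard arr) {R} (order : CrossingOrder arr R) (a k : ℕ)
    (lines : ∀ {u} → u ∈ range a (suc k) → Arrangement.Line arr u)
    {X} (model : Model arr R (range a (suc k)) X) where

    private
      b = a + k

      last-unique : Unique (b ∷ range a k)
      last-unique = All.tabulate (λ v∈ e → <-irrefl (sym e) (proj₂ (∈-range⁻ v∈))) ∷ range-unique a k

      module CD = ContractD arr order b (range a k) last-unique
        (λ u∈ → lines (∈-resp-↭ (↭-sym (range-last a k)) u∈)) (model-↭ (range-last a k) model)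
        (λ {v} v∈ → trans (st v b) (<ᵇ-true⁺ (proj₂ (∈-range⁻ v∈))))
      module CA = ContractA arr order a (range (suc a) k) (range-unique a (suc k)) lines model
        (λ {v} v∈ → trans (st a v) (<ᵇ-true⁺ (proj₁ (∈-range⁻ v∈))))

    model-D : Model arr R (range a k) (contract X D k)
    model-D = subst (λ c → Model arr R (range a k) (contract X D c)) (length-range a k) CD.contract-model

    model-A : Model arr R (range (suc a) k) (contract X A k)
    model-A = subst (λ c → Model arr R (range (suc a) k) (contract X A c))
      (length-range (suc a) k) CA.contract-model

    pairs : List (ℕ × ℕ)
    pairs = CD.rightPairs

    ind-D : ind X D k ≡ length pairs
    ind-D = trans (cong (ind X D) (sym (length-range a k))) CD.ind≡length-rightPairs

    right-pairs : RightPairs arr b (range a k) pairs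
    right-pairs = record { unique = CD.rightPairs-unique ; sound = CD.∈-rightPairs⁻ ; complete = CD.∈-rightPairs⁺ }

  -- `k + 2` lines become two after `k` contractions. Prescribing the first direction of `δs` yields
  -- the hypothesis for each of the two contractions.
  agree : ∀ k a {X Y} →
    (∀ {u} → u ∈ range a (suc (suc k)) → Arrangement.Line arr₁ u) →
    (∀ {u} → u ∈ range a (suc (suc k)) → Arrangement.Line arr₂ u) →
    Model arr₁ R₁ (range a (suc (suc k))) X → Model arr₂ R₂ (range a (suc (suc k))) Y →
    (∀ δs → length δs ≡ k → indGo (suc k) δs X ≡ indGo (suc k) δs Y) → Agree arr₁ arr₂ (range a (suc (suc k)))
  agree zero    a _ _ _ _ _ = agree-pair a
  agree (suc k) a lines₁ lines₂ M₁ M₂ same =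
    AgreeStep.agree-step arr₁ arr₂ st₁ st₂ a (suc k) lines₁ lines₂
      (agree k a (lines₁ ∘ initial) (lines₂ ∘ initial) C₁.model-D C₂.model-D
        (λ δs l → proj₂ (∷-injective (same (D ∷ δs) (cong suc l)))))
      (agree k (suc a) (lines₁ ∘ there) (lines₂ ∘ there) C₁.model-A C₂.model-A
        (λ δs l → proj₂ (∷-injective (same (A ∷ δs) (cong suc l)))))
      C₁.right-pairs C₂.right-pairs
      (trans (sym C₁.ind-D) (trans ind-same C₂.ind-D))
    where
    module C₁ = Contractions arr₁ st₁ order₁ a (suc (suc k)) lines₁ M₁
    module C₂ = Contractions arr₂ st₂ order₂ a (suc (suc k)) lines₂ M₂
    initial : ∀ {u} → u ∈ range a (suc (suc k)) → u ∈ range a (suc (suc (suc k)))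
    initial u∈ = ∈-resp-↭ (↭-sym (range-last a (suc (suc k)))) (there u∈)
    -- Every sequence that starts with `D` shows this index first; the rest is filler of the
    -- required length.
    ind-same = proj₁ (∷-injective (same (D ∷ replicate k D) (cong suc (length-replicate k))))

-- Recovering the word poset from the triple data

∼-sym : ∀ {P Q} → P ∼ Q → Q ∼ P
∼-sym {P} {Q} e = record
  { iso = ↔-sym iso
  ; le-pres = λ x y → trans (cong₂ (le Q) (sym (strictlyInverseˡ x)) (sym (strictlyInverseˡ y)))
    (sym (le-pres (from x) (from y)))
  ; col-pres = λ x → trans (sym (col-pres (from x))) (cong (col Q) (strictlyInverseˡ x)) }
  where
  open _∼_ e
  open Inverse iso

∼-trans : ∀ {P Q S} → P ∼ Q → Q ∼ S → P ∼ S
∼-trans e f = record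
  { iso = ↔-trans (_∼_.iso e) (_∼_.iso f)
  ; le-pres = λ x y → trans (_∼_.le-pres e x y) (_∼_.le-pres f _ _)
  ; col-pres = λ x → trans (_∼_.col-pres f _) (_∼_.col-pres e x) }

module Matching {m₁ m₂} (arr₁ : Arrangement m₁) (arr₂ : Arrangement m₂) (st₁ : Standard arr₁) (st₂ : Standard arr₂)
  {R} (order₂ : CrossingOrder arr₂ R) (ls : List ℕ) (unique : Unique ls)
  (inside : ∀ s → Arrangement.lo arr₁ s ∈ ls × Arrangement.hi arr₁ s ∈ ls)
  (lines₂ : ∀ {u} → u ∈ ls → Arrangement.Line arr₂ u)
  (agr : Agree arr₁ arr₂ ls) where

  private
    module A₁ = Arrangement arr₁
    module A₂ = Arrangement arr₂
    module P₁ = ArrangementProperties arr₁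
    module P₂ = ArrangementProperties arr₂
    module S₁ = StandardProperties arr₁ st₁
    module S₂ = StandardProperties arr₂ st₂
    module L₁ = Levels arr₁ ls unique
    module L₂ = Levels arr₂ ls unique
    open CrossingOrder order₂

  matching : ∀ s → ∃ λ t → A₂.lo t ≡ A₁.lo s × A₂.hi t ≡ A₁.hi s
  matching s = S₂.lines-cross-< (lines₂ (proj₁ (inside s))) (lines₂ (proj₂ (inside s))) (S₁.lo<hi s)

  match : Fin m₁ → Fin m₂
  match s = proj₁ (matching s)

  match-lo : ∀ s → A₂.lo (match s) ≡ A₁.lo s
  match-lo s = proj₁ (proj₂ (matching s))

  match-hi : ∀ s → A₂.hi (match s) ≡ A₁.hi s
  match-hi s = proj₂ (proj₂ (matching s))

  match-unique : ∀ s t → A₂.lo t ≡ A₁.lo s → A₂.hi t ≡ A₁.hi s → match s ≡ t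
  match-unique s t e e′ = A₂.once (match s) t (inj₁ (trans (match-lo s) (sym e) , trans (match-hi s) (sym e′)))

  match-on : ∀ {u s} → P₁.On u s → P₂.On u (match s)
  match-on (inj₁ e) = inj₁ (trans e (sym (match-lo _)))
  match-on (inj₂ e) = inj₂ (trans e (sym (match-hi _)))

  match-on⁻ : ∀ {u s} → P₂.On u (match s) → P₁.On u s
  match-on⁻ (inj₁ e) = inj₁ (trans e (match-lo _))
  match-on⁻ (inj₂ e) = inj₂ (trans e (match-hi _))

  match-crosses : ∀ {s u v} → A₁.Crosses s u v → A₂.Crosses (match s) u v
  match-crosses (inj₁ (e , e′)) = inj₁ (trans e (sym (match-lo _)) , trans e′ (sym (match-hi _)))
  match-crosses (inj₂ (e , e′)) = inj₂ (trans e (sym (match-hi _)) , trans e′ (sym (match-lo _)))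

  match-level : ∀ s → L₂.level (toℕ (match s)) (A₂.lo (match s)) ≡ L₁.level (toℕ s) (A₁.lo s)
  match-level s = count-cong λ w∈ →
    sym (agr s (match s) (sym (match-lo s)) (sym (match-hi s)) (proj₁ (inside s)) (proj₂ (inside s)) w∈)

  on-∈ : ∀ {u s} → P₁.On u s → u ∈ ls
  on-∈ (inj₁ refl) = proj₁ (inside _)
  on-∈ (inj₂ refl) = proj₂ (inside _)

  agree-on : ∀ {s u} → P₁.On u s → ∀ {w} → w ∈ ls → ¬ P₁.On w s →
             A₁.below (toℕ s) w u ≡ A₂.below (toℕ (match s)) w u
  agree-on {s} {u} us {w} w∈ ¬ws = trans (to-lo₁ us) (trans agr-lo (sym (to-lo₂ us)))
    where
    agr-lo : A₁.below (toℕ s) w (A₁.lo s) ≡ A₂.below (toℕ (match s)) w (A₂.lo (match s))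
    agr-lo = agr s (match s) (sym (match-lo s)) (sym (match-hi s)) (proj₁ (inside s)) (proj₂ (inside s)) w∈
    to-lo₁ : P₁.On u s → A₁.below (toℕ s) w u ≡ A₁.below (toℕ s) w (A₁.lo s)
    to-lo₁ (inj₁ refl) = refl
    to-lo₁ (inj₂ refl) = sym (A₁.below-adj s (¬ws ∘ inj₁) (¬ws ∘ inj₂))
    to-lo₂ : P₁.On u s → A₂.below (toℕ (match s)) w u ≡ A₂.below (toℕ (match s)) w (A₂.lo (match s))
    to-lo₂ (inj₁ refl) = cong (A₂.below (toℕ (match s)) w) (sym (match-lo s))
    to-lo₂ (inj₂ refl) = trans (cong (A₂.below (toℕ (match s)) w) (sym (match-hi s)))
      (sym (A₂.below-adj (match s) (¬ws ∘ match-on⁻ ∘ inj₁) (¬ws ∘ match-on⁻ ∘ inj₂)))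

  -- Let `w` be the line that `u` meets at `t`. At `s` these two are still in their initial order,
  -- and by agreement also at `match s`; so `match s` cannot come after `match t`, where they cross.
  -- It cannot be equal to it either, since `w` is not on `s`.
  match-< : ∀ {s t u} → P₁.On u s → P₁.On u t → toℕ s < toℕ t → toℕ (match s) < toℕ (match t)
  match-< {s} {t} {u} us ut l with w , u≢w , ct ← P₁.partner ut = ≰⇒> λ l′ → conflict (m≤n⇒m<n∨m≡n l′)
    where
    ct′ = P₁.Crosses-sym ct
    ct₂ = P₂.Crosses-sym (match-crosses ct)
    ¬ws : ¬ P₁.On w s
    ¬ws ws = <-irrefl (cong toℕ (P₁.once′ (P₁.on-both u≢w us ws) ct)) l
    unchanged : A₂.below (toℕ (match s)) w u ≡ A₂.below 0 w u
    unchanged = trans (sym (agree-on us (on-∈ (P₁.Crosses⇒On ct′)) ¬ws)) (trans (P₁.below-before ct′ (<⇒≤ l))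
      (trans (sym (P₁.below-before ct′ z≤n)) (trans (st₁ w u) (sym (st₂ w u)))))
    conflict : toℕ (match t) < toℕ (match s) ⊎ toℕ (match t) ≡ toℕ (match s) → ⊥
    conflict (inj₁ l′) = Boolₚ.not-¬ unchanged (P₂.below-after-0 ct₂ l′ (<⇒≤ (toℕ<n (match s))))
    conflict (inj₂ e) = ¬ws (match-on⁻ (P₂.Crosses⇒On (subst (λ r → A₂.Crosses r w u) (toℕ-injective e) ct₂)))

  -- The level invariant again, now for the order of the second word pulled back along `match`;
  -- `match-<` makes it applicable to crossings on a common line.
  same-level⇒R : ∀ s t {u v} → P₁.On u s → P₁.On v t → L₁.level (toℕ s) u ≡ L₁.level (toℕ t) v → toℕ s < toℕ t →
                 R (match s) (match t) ≡ true
  same-level⇒R s t = L₁.same-level⇒≼ (λ s t → R (match s) (match t) ≡ true) R-refl R-trans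
    (λ us ut l → R-share (match-on us) (match-on ut) (match-< us ut l)) (inside s) (inside t)

module Reconstruction (n : ℕ) (is js : List ℕ)
  (red₁ : IsReducedWordOf n (w0 n) is) (red₂ : IsReducedWordOf n (w0 n) js)
  (agr : Agree (WordArrangement.arrangement n is red₁) (WordArrangement.arrangement n js red₂) (range 1 (suc n))) where

  private
    module O₁ = WordOrder n is red₁
    module O₂ = WordOrder n js red₂
    module R₁ = Reachability is
    arr₁ = WordArrangement.arrangement n is red₁
    arr₂ = WordArrangement.arrangement n js red₂
    module L₁ = Levels arr₁ O₁.lines (range-unique 1 (suc n))

    inside : ∀ s → lower is s ∈ O₁.lines × upper is s ∈ O₁.lines
    inside s = O₁.line⇒∈ (O₁.lower-line s) , O₁.line⇒∈ (O₁.upper-line s)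

  open Matching arr₁ arr₂ (λ _ _ → refl) (λ _ _ → refl) O₂.order O₁.lines (range-unique 1 (suc n)) inside
    (λ u∈ → proj₁ (∈-range⁻ u∈) , ≤-pred (proj₂ (∈-range⁻ u∈))) agr public

  private
    _≼_ : Fin (length is) → Fin (length is) → Set
    s ≼ t = le (wordPoset js) (match s) (match t) ≡ true

  -- If two letters differ by one, the upper line at one crossing is at the level of the lower line
  -- at the other. So the crossings touch a common level even if they share no line.
  cover⇒≼ : ∀ s t → R₁.cover s t ≡ true → s ≼ t
  cover⇒≼ s t c with R₁.cover⁻ c
  ... | l , inj₁ e = same-level⇒R s t (inj₂ refl) (inj₁ refl)
    (trans (L₁.level-hi {s} (inside s)) (suc-injective (trans (cong suc (sym (O₁.letter≡level s))) (trans e (O₁.letter≡level t))))) l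
  ... | l , inj₂ e = same-level⇒R s t (inj₁ refl) (inj₂ refl)
    (sym (trans (L₁.level-hi {t} (inside t)) (suc-injective (trans (cong suc (sym (O₁.letter≡level t))) (trans e (O₁.letter≡level s)))))) l

  Path⇒≼ : ∀ {s t} → R₁.Path s t → s ≼ t
  Path⇒≼ R₁.nil                     = CrossingOrder.R-refl O₂.order
  Path⇒≼ (R₁.cons {j} {l} {k} c p) = CrossingOrder.R-trans O₂.order (cover⇒≼ j l c) (Path⇒≼ p)

  match-le : ∀ {s t} → le (wordPoset is) s t ≡ true → s ≼ t
  match-le e = Path⇒≼ (R₁.le⇒Path e)

  match-letter : ∀ s → lookup js (match s) ≡ lookup is s
  match-letter s = trans (O₂.letter≡level (match s)) (trans (cong suc (match-level s)) (sym (O₁.letter≡level s)))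

-- `Agree` is symmetric, so there is a monotone map in each direction. A crossing is determined by
-- its lines, which makes the maps mutually inverse.
agree⇒∼ : ∀ n is js (red₁ : IsReducedWordOf n (w0 n) is) (red₂ : IsReducedWordOf n (w0 n) js) →
  Agree (WordArrangement.arrangement n is red₁) (WordArrangement.arrangement n js red₂) (range 1 (suc n)) →
  wordPoset is ∼ wordPoset js
agree⇒∼ n is js red₁ red₂ agr = record
  { iso = mk↔ₛ′ F.match B.match match-back back-match
  ; le-pres = λ s t → true⇔⇒≡ F.match-le
      (λ e → subst₂ (λ s t → le (wordPoset is) s t ≡ true) (back-match s) (back-match t) (B.match-le e))
  ; col-pres = F.match-letter
  }
  where
  module F = Reconstruction n is js red₁ red₂ agr
  module B = Reconstruction n js is red₂ red₁
    (Agree-sym (WordArrangement.arrangement n is red₁) (WordArrangement.arrangement n js red₂) agr)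
  match-back : ∀ t → F.match (B.match t) ≡ t
  match-back t = F.match-unique (B.match t) t (sym (B.match-lo t)) (sym (B.match-hi t))
  back-match : ∀ s → B.match (F.match s) ≡ s
  back-match s = B.match-unique (F.match s) s (sym (F.match-lo s)) (sym (F.match-hi s))

-- Conclusion

∃-vec : ∀ {X : Set} {k} (xs : List X) → length xs ≡ k → ∃ λ (v : Vec X k) → toList v ≡ xs
∃-vec xs refl = fromList xs , toList∘fromList xs

theorem5p1 : (n : ℕ) → 1 ≤ n → (P Q : WordPoset) → InP-w0 n P → InP-w0 n Q →
    (∀ (δ : Vec Dir (n ∸ 1)) → indSeq n δ P ≡ indSeq n δ Q) → P ∼ Q
theorem5p1 (suc k) _ P Q (is , red₁ , P∼) (js , red₂ , Q∼) same =
  ∼-trans P∼ (∼-trans (agree⇒∼ n is js red₁ red₂ agr) (∼-sym Q∼))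
  where
  n = suc k
  module O₁ = WordOrder n is red₁
  module O₂ = WordOrder n js red₂
  line : ∀ {u} → u ∈ range 1 (suc n) → 1 ≤ u × u ≤ suc n
  line u∈ with l , l′ ← ∈-range⁻ u∈ = l , ≤-pred l′
  -- `indSeq` reverses both the directions and the result. Feeding it the reversed sequence and
  -- cancelling the outer reversal leaves `indGo`.
  same-indices : ∀ δs → length δs ≡ k → indGo n δs P ≡ indGo n δs Q
  same-indices δs l with δ , e ← ∃-vec (reverse δs) (trans (length-reverse δs) l) =
    subst (λ ds → indGo n ds P ≡ indGo n ds Q) (trans (cong reverse e) (reverse-involutive δs)) (reverse-injective (same δ))
  agr : Agree (WordArrangement.arrangement n is red₁) (WordArrangement.arrangement n js red₂) (range 1 (suc n))
  agr = AgreeInduction.agree _ _ (λ _ _ → refl) (λ _ _ → refl) O₁.order O₂.order k 1 line line (O₁.model P∼)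
    (O₂.model Q∼) same-indices
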